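{- For every integer $d\geq 1$ there are constants $C_d>0$ and $p_0=p_0(d)$, depending only on $d$, such that the following holds for every prime $p\geq p_0$ and every integer $k\geq 1$. Let $\Gamma$ be a set of $d$ integers. Then there is an integer $x$ with $1\leq x<p$ such that $$\max_{r\in\Gamma}\left\|x^k\frac{r}{p}\right\|\leq C_d\, p^{ -1/(2d)}\,(\log p)\, k^{1/d}.$$
   Context: For real $\theta$, $\|\theta\|$ denotes the distance from $\theta$ to the nearest integer. The paper writes the conclusion as $\ll_d$, where $X\ll_d Y$ means that $X\leq cY$ for a constant $c$ depending only on $d$, once $p$ is sufficiently large. -}

module Defs where

open import Algebra.Definitions.RawSemiring using () renaming (_^_ to pow)
open import Data.Integer.Base as ℤ using (+_)
open import Data.List.Base using (List; foldr; map)
open import Data.Nat.Base as ℕ using (ℕ; zero; suc; _!)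
open import Data.Nat.Properties using (_!≢0)
open import Data.Product.Base using (∃; ∃-syntax; _×_; _,_)
open import Data.Rational.Base
open import Data.Rational.Properties
open import Data.Sum.Base using (inj₁; inj₂)
open import Relation.Binary.PropositionalEquality using (_≡_; refl; sym; trans; cong; subst)
open import Relation.Nullary using (¬_)

infixr 8 _^_
_^_ : ℚ → ℕ → ℚ
_^_ = pow +-*-rawSemiring

-- Nonnegative reals as one-sided Dedekind cuts: x is given by the set of
-- rationals strictly greater than x.
record ℝ≥0 : Set₁ where
  field
    upper     : ℚ → Set
    positive′ : ∀ {q} → upper q → 0ℚ < q
    inhabited : ∃ upper
    upward    : ∀ {q r} → upper q → q < r → upper r
    rounded   : ∀ {q} → upper q → ∃[ r ] (upper r × r < q)

open ℝ≥0

infix 4 _≤ᵣ_ _<ᵣ_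
_≤ᵣ_ : ℝ≥0 → ℝ≥0 → Set
x ≤ᵣ y = ∀ {q} → upper y q → upper x q

_<ᵣ_ : ℝ≥0 → ℝ≥0 → Set
x <ᵣ y = ∃[ q ] (upper x q × ¬ upper y q)

-- Infimum of the nonnegative rationals satisfying S.
inf : (S : ℚ → Set) → ∃[ s ] (S s × 0ℚ ≤ s) → ℝ≥0
inf S (s₀ , Ss₀ , 0≤s₀) = record
  { upper     = λ q → ∃[ s ] (S s × 0ℚ ≤ s × s < q)
  ; positive′ = λ (_ , _ , 0≤s , s<q) → ≤-<-trans 0≤s s<q
  ; inhabited = s₀ + 1ℚ , s₀ , Ss₀ , 0≤s₀ , s<s+1 s₀
  ; upward    = λ (s , Ss , 0≤s , s<q) q<r → s , Ss , 0≤s , <-trans s<q q<r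
  ; rounded   = λ (s , Ss , 0≤s , s<q) →
      let (r , s<r , r<q) = <-dense s<q in r , (s , Ss , 0≤s , s<r) , r<q
  }
  where
  s<s+1 : ∀ s → s < s + 1ℚ
  s<s+1 s = subst (_< s + 1ℚ) (+-identityʳ s) (+-monoʳ-< s (positive⁻¹ 1ℚ))

fromℚ : (q : ℚ) → .{{NonNegative q}} → ℝ≥0
fromℚ q = inf (_≡ q) (q , refl , nonNegative⁻¹ q)

_/ᵣ_ : (m n : ℕ) → .{{ℕ.NonZero n}} → ℝ≥0
m /ᵣ n = fromℚ (+ m / n) {{normalize-nonNeg m n}}

fromℕ : ℕ → ℝ≥0
fromℕ n = n /ᵣ 1

0ᵣ : ℝ≥0
0ᵣ = fromℕ 0

infixl 7 _*ᵣ_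
_*ᵣ_ : ℝ≥0 → ℝ≥0 → ℝ≥0
x *ᵣ y = inf (λ s → ∃[ a ] ∃[ b ] (upper x a × upper y b × s ≡ a * b))
  (let (a , xa) = inhabited x ; (b , yb) = inhabited y in
   a * b , (a , b , xa , yb , refl) ,
   nonNegative⁻¹ (a * b) {{nonNeg*nonNeg⇒nonNeg a {{nonNegative (<⇒≤ (positive′ x xa))}}
                                                 b {{nonNegative (<⇒≤ (positive′ y yb))}}}})

infixl 6 _⊔ᵣ_
_⊔ᵣ_ : ℝ≥0 → ℝ≥0 → ℝ≥0
x ⊔ᵣ y = record
  { upper     = λ q → upper x q × upper y q
  ; positive′ = λ (xq , _) → positive′ x xq
  ; inhabited =
      let (a , xa) = inhabited x ; (b , yb) = inhabited y
          0<a = positive′ x xa ; 0<b = positive′ y yb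
      in a + b
       , upward x xa (subst (_< a + b) (+-identityʳ a) (+-monoʳ-< a 0<b))
       , upward y yb (subst (_< a + b) (+-identityˡ b) (+-monoˡ-< b 0<a))
  ; upward    = λ (xq , yq) q<r → upward x xq q<r , upward y yq q<r
  ; rounded   = λ (xq , yq) →
      let (r , xr , r<q) = rounded x xq
          (s , ys , s<q) = rounded y yq
          (t , m<t , t<q) = <-dense (⊔-lub-< r<q s<q)
      in t , (upward x xr (≤-<-trans (p≤p⊔q r s) m<t)
            , upward y ys (≤-<-trans (p≤q⊔p r s) m<t)) , t<q
  }
  where
  ⊔-lub-< : ∀ {r s q} → r < q → s < q → r ⊔ s < q
  ⊔-lub-< {r} {s} r<q s<q with ⊔-sel r s
  ... | inj₁ e = subst (_< _) (sym e) r<q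
  ... | inj₂ e = subst (_< _) (sym e) s<q

-- The base value 0 is harmless: all values are nonnegative.
maxOver : {A : Set} → List A → (A → ℝ≥0) → ℝ≥0
maxOver Γ f = foldr _⊔ᵣ_ 0ᵣ (map f Γ)

1≤1+u : ∀ {u} → 0ℚ ≤ u → 1ℚ ≤ 1ℚ + u
1≤1+u 0≤u = +-monoʳ-≤ 1ℚ 0≤u

^-≥1 : ∀ {v} → 1ℚ ≤ v → ∀ n → 1ℚ ≤ v ^ n
^-≥1     1≤v zero    = ≤-refl
^-≥1 {v} 1≤v (suc n) = ≤-trans 1≤v (subst (_≤ v * v ^ n) (*-identityʳ v)
  (*-monoˡ-≤-nonNeg v {{nonNegative (≤-trans (nonNegative⁻¹ 1ℚ) 1≤v)}} (^-≥1 1≤v n)))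

v≤v^n : ∀ {v} → 1ℚ ≤ v → ∀ n → .{{ℕ.NonZero n}} → v ≤ v ^ n
v≤v^n {v} 1≤v (suc n) = subst (_≤ v * v ^ n) (*-identityʳ v)
  (*-monoˡ-≤-nonNeg v {{nonNegative (≤-trans (nonNegative⁻¹ 1ℚ) 1≤v)}} (^-≥1 1≤v n))

u<1+u : ∀ u → u < 1ℚ + u
u<1+u u = subst (_< 1ℚ + u) (+-identityˡ u) (+-monoˡ-< u (positive⁻¹ 1ℚ))

-- x^(1/n), as the infimum of the rationals s ≥ 0 with x < sⁿ.
root : (n : ℕ) → .{{ℕ.NonZero n}} → ℝ≥0 → ℝ≥0
root n x = inf (λ s → upper x (s ^ n))
  (let (u , xu) = inhabited x
       1≤v = 1≤1+u (<⇒≤ (positive′ x xu))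
   in 1ℚ + u , upward x xu (<-≤-trans (u<1+u u) (v≤v^n 1≤v n))
    , ≤-trans (nonNegative⁻¹ 1ℚ) 1≤v)

-- Σ_{i ≤ N} sⁱ / i!
expSum : ℕ → ℚ → ℚ
expSum zero    _ = 1ℚ
expSum (suc N) s = expSum N s + s ^ suc N * (+ 1 / (suc N !)) {{suc N !≢0}}

-- Natural logarithm, as the infimum of the rationals s ≥ 0 with n < exp s;
-- as the terms of the exponential series are nonnegative for s ≥ 0, n < exp s
-- holds exactly when some partial sum exceeds n.
log : (n : ℕ) → .{{ℕ.NonZero n}} → ℝ≥0
log n = inf (λ s → ∃[ N ] (+ n / 1 < expSum N s))
  (+ n / 1 , (1 , subst (+ n / 1 <_) (sym (e (+ n / 1))) (u<1+u (+ n / 1)))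
  , nonNegative⁻¹ (+ n / 1) {{normalize-nonNeg n 1}})
  where
  e : ∀ t → expSum 1 t ≡ 1ℚ + t
  e t = cong (λ u → 1ℚ + u) (trans (*-identityʳ (t * 1ℚ)) (*-identityʳ t))

-- Distance to the nearest integer, for rational θ (here θ = xᵏ r / p).
‖_‖ : ℚ → ℝ≥0
‖ θ ‖ = fromℚ ∣ θ - round θ / 1 ∣ {{∣-∣-nonNeg (θ - round θ / 1)}}

{-# OPTIONS --safe #-}
module Submission where

-- Cut [0, p) into D intervals and colour m ∈ ℤ/p by the cells of m r, r ∈ Γ;
-- there are K = Dᵈ colours. If m′ − m ≡ xᵏ with x ≢ 0 for some m, m′ of the same
-- colour, then every xᵏ r / p is within 1/D of an integer. Suppose no such pair
-- exists, and let A be a colour class, a = |A| and T(s, t) = #{x : s xᵏ + t ∈ A}.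
-- Two points of the plane lie on at most one non-vertical line and xᵏ ≡ c has at
-- most k roots, so Σ (T − a)² ≤ k p² a over all s, t; but T(yᵏ, t) = 1 for y ≢ 0
-- and t ∈ A, and these p − 1 values of y give each s = yᵏ at most k times, whence
-- (p − 1) (a − 1)² ≤ k² p² if a > 0. As K a ≥ p for some colour, this forces
-- K k ≫ √p, so D may be taken of order (√p / k)^(1/d). Of the logarithm only
-- log p ≥ 1/2 is used.

open import Defs hiding (_^_)
open import Data.Fin.Base as Fin using (Fin; zero; suc; toℕ; fromℕ<; funToFin; finToFun)
import Data.Fin.Properties as Fin
open import Data.Integer.Base as ℤ using (ℤ; +_; 0ℤ; 1ℤ)
import Data.Integer.Properties as ℤ
open import Data.List.Base using (List; []; _∷_; length; lookup)
open import Data.List.Relation.Unary.Unique.Propositional using (Unique)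
open import Data.Nat.Base as ℕ using (ℕ; zero; suc; NonZero; z≤n; s≤s; _!)
import Data.Nat.Divisibility as ℕ
import Data.Nat.DivMod as ℕ
open import Data.Nat.Primality using (Prime; prime⇒nonZero; prime⇒nonTrivial; euclidsLemma; ¬prime[0])
import Data.Nat.Properties as ℕ
open import Data.Nat.Properties using (m*n≢0)
open import Data.Nat.Tactic.RingSolver using () renaming (solve-∀ to ℕ-solve-∀)
open import Data.Product.Base using (∃-syntax; _×_; _,_)
open import Data.Rational.Base using (_/_)
open import Data.Sum.Base using (_⊎_; inj₁; inj₂)
open import Function.Base using (_∘_)
open import Relation.Binary.PropositionalEquality
open import Relation.Nullary

module PowerDifferences where

  open import Data.Bool.Base using (if_then_else_)
  open import Data.Integer.Base using (_+_; _*_; _-_; -_; _≤_; _^_)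
  open import Data.Integer.DivMod using (n%ℕd<d; a≡a%ℕn+[a/ℕn]*n)
  open import Data.Integer.Divisibility.Signed
  open import Data.Integer.Tactic.RingSolver using (solve-∀)
  open import Algebra.Properties.Semiring.Sum ℤ.+-*-semiring
    using (sum; sum-syntax; sum-cong-≗; ∑-comm; ∑-distrib-+; *-distribˡ-sum; *-distribʳ-sum; sum-replicate-zero)

  -- Finite sums of integers and indicator functions.

  sum-mono : ∀ {n} {f g : Fin n → ℤ} → (∀ i → f i ≤ g i) → sum f ≤ sum g
  sum-mono {zero}  f≤g = ℤ.≤-refl
  sum-mono {suc n} f≤g = ℤ.+-mono-≤ (f≤g zero) (sum-mono (f≤g ∘ suc))

  sum-const : ∀ n c → ∑[ i < n ] c ≡ + n * c
  sum-const zero    c = sym (ℤ.*-zeroˡ c)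
  sum-const (suc n) c = trans (cong (λ s → c + s) (sum-const n c)) (sym (ℤ.suc-* (+ n) c))

  sum-nonneg : ∀ {n} {f : Fin n → ℤ} → (∀ i → 0ℤ ≤ f i) → 0ℤ ≤ sum f
  sum-nonneg {n} 0≤f = ℤ.≤-trans (ℤ.≤-reflexive (sym (sum-replicate-zero n))) (sum-mono 0≤f)

  term≤sum : ∀ {n} {f : Fin n → ℤ} → (∀ i → 0ℤ ≤ f i) → ∀ j → f j ≤ sum f
  term≤sum {f = f} 0≤f zero    =
    subst (_≤ sum f) (ℤ.+-identityʳ (f zero)) (ℤ.+-monoʳ-≤ (f zero) (sum-nonneg (0≤f ∘ suc)))
  term≤sum {f = f} 0≤f (suc j) = ℤ.≤-trans (term≤sum (0≤f ∘ suc) j)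
    (subst (_≤ sum f) (ℤ.+-identityˡ (sum (f ∘ suc))) (ℤ.+-monoˡ-≤ _ (0≤f zero)))

  *-nonNeg : ∀ {a b} → 0ℤ ≤ a → 0ℤ ≤ b → 0ℤ ≤ a * b
  *-nonNeg {b = b} 0≤a 0≤b = ℤ.*-monoʳ-≤-nonNeg b {{ℤ.nonNegative 0≤b}} 0≤a

  square-nonNeg : ∀ i → 0ℤ ≤ i * i
  square-nonNeg (+ n)      = subst (0ℤ ≤_) (ℤ.pos-* n n) (ℤ.+≤+ z≤n)
  square-nonNeg ℤ.-[1+ n ] = ℤ.+≤+ z≤n

  𝟙 : {P : Set} → Dec P → ℤ
  𝟙 P? = if does P? then 1ℤ else 0ℤ

  module _ {P : Set} where

    𝟙-true : (P? : Dec P) → P → 𝟙 P? ≡ 1ℤ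
    𝟙-true (yes _) p = refl
    𝟙-true (no ¬p) p = contradiction p ¬p

    𝟙-false : (P? : Dec P) → ¬ P → 𝟙 P? ≡ 0ℤ
    𝟙-false (yes p) ¬p = contradiction p ¬p
    𝟙-false (no _)  ¬p = refl

    𝟙-nonNeg : (P? : Dec P) → 0ℤ ≤ 𝟙 P?
    𝟙-nonNeg (yes _) = ℤ.+≤+ z≤n
    𝟙-nonNeg (no _)  = ℤ.≤-refl

    𝟙≤1 : (P? : Dec P) → 𝟙 P? ≤ 1ℤ
    𝟙≤1 (yes _) = ℤ.≤-refl
    𝟙≤1 (no _)  = ℤ.+≤+ z≤n

  𝟙-⊎ : {P Q R : Set} (P? : Dec P) (Q? : Dec Q) (R? : Dec R) → (P → Q ⊎ R) → 𝟙 P? ≤ 𝟙 Q? + 𝟙 R?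
  𝟙-⊎ (no _)  Q? R? f = ℤ.+-mono-≤ (𝟙-nonNeg Q?) (𝟙-nonNeg R?)
  𝟙-⊎ (yes p) Q? R? f with f p
  ... | inj₁ q = ℤ.+-mono-≤ (ℤ.≤-reflexive (sym (𝟙-true Q? q))) (𝟙-nonNeg R?)
  ... | inj₂ r = ℤ.+-mono-≤ (𝟙-nonNeg Q?) (ℤ.≤-reflexive (sym (𝟙-true R? r)))

  ∑-𝟙-≟ : ∀ {n} (j : Fin n) → ∑[ i < n ] 𝟙 (i Fin.≟ j) ≡ 1ℤ
  ∑-𝟙-≟ {suc n} zero    = cong (λ s → 1ℤ + s) (sum-replicate-zero n)
  ∑-𝟙-≟ {suc n} (suc j) = trans (ℤ.+-identityˡ (∑[ i < n ] 𝟙 (suc i Fin.≟ suc j)))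
    (trans (sum-cong-≗ (λ i → step i)) (∑-𝟙-≟ j))
    where
    step : ∀ i → 𝟙 (suc i Fin.≟ suc j) ≡ 𝟙 (i Fin.≟ j)
    step i with i Fin.≟ j
    ... | yes _ = refl
    ... | no  _ = refl

  -- The numerical contradiction behind the choice of K, for a class of b + 1 elements. Since 2K ≤
  -- p, the inequality p ≤ K (b + 1) gives p ≤ 2Kb. Inserted into m b² ≤ k² p², this yields m ≤ 4
  -- (Kk)², hence 2m ≤ p = m + 1 and p ≤ 2, against 8 ≤ p.
  no-large-class : ∀ {m k K b} → 1 ℕ.≤ k → 1 ℕ.≤ K → 8 ℕ.* ((K ℕ.* k) ℕ.* (K ℕ.* k)) ℕ.≤ suc m →
    m ℕ.* (suc b ℕ.* (b ℕ.* b)) ℕ.≤ k ℕ.* (suc m ℕ.* (k ℕ.* (suc m ℕ.* suc b))) →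
    ¬ (suc m ℕ.≤ K ℕ.* suc b)
  no-large-class {m} {k} {K} {b} 1≤k 1≤K 8Q²≤p bound p≤K[1+b] =
    ℕ.<⇒≱ (s≤s (s≤s (s≤s (z≤n {5})))) (ℕ.≤-trans 8≤p (s≤s m≤1))
    where
    open ℕ.≤-Reasoning
    p = suc m
    Q² = (K ℕ.* k) ℕ.* (K ℕ.* k)

    1≤Kk : 1 ℕ.≤ K ℕ.* k
    1≤Kk = ℕ.*-mono-≤ 1≤K 1≤k

    8≤p : 8 ℕ.≤ p
    8≤p = ℕ.≤-trans (ℕ.*-monoʳ-≤ 8 (ℕ.*-mono-≤ 1≤Kk 1≤Kk)) 8Q²≤p

    2K≤p : 2 ℕ.* K ℕ.≤ p
    2K≤p = begin
      2 ℕ.* K                       ≡⟨ cong (2 ℕ.*_) (ℕ.*-identityʳ K) ⟨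
      2 ℕ.* (K ℕ.* 1)               ≤⟨ ℕ.*-mono-≤ {2} {8} (s≤s (s≤s z≤n)) (ℕ.*-mono-≤ K≤Kk 1≤Kk) ⟩
      8 ℕ.* Q²                      ≤⟨ 8Q²≤p ⟩
      p                             ∎
      where
      K≤Kk : K ℕ.≤ K ℕ.* k
      K≤Kk = ℕ.≤-trans (ℕ.≤-reflexive (sym (ℕ.*-identityʳ K))) (ℕ.*-monoʳ-≤ K 1≤k)

    p≤2Kb : p ℕ.≤ 2 ℕ.* K ℕ.* b
    p≤2Kb = ℕ.+-cancelˡ-≤ p p (2 ℕ.* K ℕ.* b) (begin
      p ℕ.+ p                       ≤⟨ ℕ.+-mono-≤ p≤K[1+b] p≤K[1+b] ⟩
      K ℕ.* suc b ℕ.+ K ℕ.* suc b   ≡⟨ lemma K b ⟩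
      2 ℕ.* K ℕ.+ 2 ℕ.* K ℕ.* b     ≤⟨ ℕ.+-monoˡ-≤ (2 ℕ.* K ℕ.* b) 2K≤p ⟩
      p ℕ.+ 2 ℕ.* K ℕ.* b           ∎)
      where
      lemma : ∀ K b → K ℕ.* suc b ℕ.+ K ℕ.* suc b ≡ 2 ℕ.* K ℕ.+ 2 ℕ.* K ℕ.* b
      lemma = ℕ-solve-∀

    mb²≤k²p² : m ℕ.* (b ℕ.* b) ℕ.≤ k ℕ.* k ℕ.* (p ℕ.* p)
    mb²≤k²p² = ℕ.*-cancelʳ-≤ (m ℕ.* (b ℕ.* b)) (k ℕ.* k ℕ.* (p ℕ.* p)) (suc b) (begin
      m ℕ.* (b ℕ.* b) ℕ.* suc b             ≡⟨ lemma m b ⟩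
      m ℕ.* (suc b ℕ.* (b ℕ.* b))           ≤⟨ bound ⟩
      k ℕ.* (p ℕ.* (k ℕ.* (p ℕ.* suc b)))   ≡⟨ lemma′ k p (suc b) ⟩
      k ℕ.* k ℕ.* (p ℕ.* p) ℕ.* suc b       ∎)
      where
      lemma : ∀ m b → m ℕ.* (b ℕ.* b) ℕ.* suc b ≡ m ℕ.* (suc b ℕ.* (b ℕ.* b))
      lemma = ℕ-solve-∀
      lemma′ : ∀ k p b → k ℕ.* (p ℕ.* (k ℕ.* (p ℕ.* b))) ≡ k ℕ.* k ℕ.* (p ℕ.* p) ℕ.* b
      lemma′ = ℕ-solve-∀

    m≤4Q² : m ℕ.≤ 4 ℕ.* Q²
    m≤4Q² = ℕ.*-cancelʳ-≤ m (4 ℕ.* Q²) (p ℕ.* p) (begin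
      m ℕ.* (p ℕ.* p)                                 ≤⟨ ℕ.*-monoʳ-≤ m (ℕ.*-mono-≤ p≤2Kb p≤2Kb) ⟩
      m ℕ.* ((2 ℕ.* K ℕ.* b) ℕ.* (2 ℕ.* K ℕ.* b))     ≡⟨ lemma m K b ⟩
      4 ℕ.* (K ℕ.* K) ℕ.* (m ℕ.* (b ℕ.* b))           ≤⟨ ℕ.*-monoʳ-≤ (4 ℕ.* (K ℕ.* K)) mb²≤k²p² ⟩
      4 ℕ.* (K ℕ.* K) ℕ.* (k ℕ.* k ℕ.* (p ℕ.* p))     ≡⟨ lemma′ K k (p ℕ.* p) ⟩
      4 ℕ.* Q² ℕ.* (p ℕ.* p)                          ∎)
      where
      lemma : ∀ m K b → m ℕ.* ((2 ℕ.* K ℕ.* b) ℕ.* (2 ℕ.* K ℕ.* b)) ≡ 4 ℕ.* (K ℕ.* K) ℕ.* (m ℕ.* (b ℕ.* b))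
      lemma = ℕ-solve-∀
      lemma′ : ∀ K k q → 4 ℕ.* (K ℕ.* K) ℕ.* (k ℕ.* k ℕ.* q) ≡ 4 ℕ.* ((K ℕ.* k) ℕ.* (K ℕ.* k)) ℕ.* q
      lemma′ = ℕ-solve-∀

    m≤1 : m ℕ.≤ 1
    m≤1 = ℕ.+-cancelʳ-≤ m m 1 (begin
      m ℕ.+ m                 ≤⟨ ℕ.+-mono-≤ m≤4Q² m≤4Q² ⟩
      4 ℕ.* Q² ℕ.+ 4 ℕ.* Q²   ≡⟨ ℕ.*-distribʳ-+ Q² 4 4 ⟨
      8 ℕ.* Q²                ≤⟨ 8Q²≤p ⟩
      p                       ∎)

  -- The equal quotients cancel, leaving the difference of two remainders below n.
  ∣-∣<-divisor : ∀ a b n .{{_ : NonZero n}} → a ℕ./ n ≡ b ℕ./ n → ℤ.∣ + a - + b ∣ ℕ.< n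
  ∣-∣<-divisor a b n e = ℕ.≤-<-trans
    (ℕ.≤-trans (ℕ.≤-reflexive (cong ℤ.∣_∣ difference)) (ℤ.∣m⊝n∣≤m⊔n (a ℕ.% n) (b ℕ.% n)))
    (ℕ.⊔-lub (ℕ.m%n<n a n) (ℕ.m%n<n b n))
    where
    open ≡-Reasoning
    lemma : ∀ r q s → (r + q) - (s + q) ≡ r - s
    lemma = solve-∀
    difference : + a - + b ≡ a ℕ.% n ℤ.⊖ b ℕ.% n
    difference = begin
      + a - + b
        ≡⟨ cong₂ (λ u v → + u - + v) (ℕ.m≡m%n+[m/n]*n a n) (trans (ℕ.m≡m%n+[m/n]*n b n) (cong (λ q → b ℕ.% n ℕ.+ q ℕ.* n) (sym e))) ⟩
      + (a ℕ.% n ℕ.+ a ℕ./ n ℕ.* n) - + (b ℕ.% n ℕ.+ a ℕ./ n ℕ.* n)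
        ≡⟨ lemma (+ (a ℕ.% n)) (+ (a ℕ./ n ℕ.* n)) (+ (b ℕ.% n)) ⟩
      + (a ℕ.% n) - + (b ℕ.% n)
        ≡⟨ ℤ.m-n≡m⊖n (a ℕ.% n) (b ℕ.% n) ⟩
      a ℕ.% n ℤ.⊖ b ℕ.% n ∎

  -- Arithmetic modulo a prime.

  module Residues (m : ℕ) (p-prime : Prime (suc m)) where

    -- With p in the form `suc m`, the nonzero residues are exactly the `suc x` with `x : Fin m`.
    p : ℕ
    p = suc m

    infix 4 _≈_
    -- A record rather than a synonym, so that x and y can be inferred from the type; the difference
    -- x - y alone does not determine them.
    record _≈_ (x y : ℤ) : Set where
      constructor mod
      field divisible : + p ∣ x - y
    open _≈_

    ≈-refl : ∀ {x} → x ≈ x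
    ≈-refl {x} = mod (divides 0ℤ (ℤ.+-inverseʳ x))

    ≈-reflexive : ∀ {x y} → x ≡ y → x ≈ y
    ≈-reflexive refl = ≈-refl

    ≈-sym : ∀ {x y} → x ≈ y → y ≈ x
    ≈-sym {x} {y} (mod e) = mod (subst (+ p ∣_) (lemma x y) (∣m⇒∣-m e))
      where
      lemma : ∀ x y → - (x - y) ≡ y - x
      lemma = solve-∀

    ≈-trans : ∀ {x y z} → x ≈ y → y ≈ z → x ≈ z
    ≈-trans {x} {y} {z} (mod e) (mod e′) = mod (subst (+ p ∣_) (lemma x y z) (∣m∣n⇒∣m+n e e′))
      where
      lemma : ∀ x y z → (x - y) + (y - z) ≡ x - z
      lemma = solve-∀

    +-cong-≈ : ∀ {x y u v} → x ≈ y → u ≈ v → x + u ≈ y + v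
    +-cong-≈ {x} {y} {u} {v} (mod e) (mod e′) =
      mod (subst (+ p ∣_) (lemma x y u v) (∣m∣n⇒∣m+n e e′))
      where
      lemma : ∀ x y u v → (x - y) + (u - v) ≡ (x + u) - (y + v)
      lemma = solve-∀

    *-cong-≈ : ∀ {x y u v} → x ≈ y → u ≈ v → x * u ≈ y * v
    *-cong-≈ {x} {y} {u} {v} (mod e) (mod e′) =
      mod (subst (+ p ∣_) (lemma x y u v) (∣m∣n⇒∣m+n (∣m⇒∣m*n u e) (∣n⇒∣m*n y e′)))
      where
      lemma : ∀ x y u v → (x - y) * u + y * (u - v) ≡ x * u - y * v
      lemma = solve-∀

    ^-cong-≈ : ∀ k {x y} → x ≈ y → x ^ k ≈ y ^ k
    ^-cong-≈ zero    e = ≈-refl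
    ^-cong-≈ (suc k) e = *-cong-≈ e (^-cong-≈ k e)

    euclid : ∀ x y → + p ∣ x * y → + p ∣ x ⊎ + p ∣ y
    euclid x y d with euclidsLemma ℤ.∣ x ∣ ℤ.∣ y ∣ p-prime (subst (p ℕ.∣_) (ℤ.abs-* x y) (∣⇒∣ᵤ d))
    ... | inj₁ e = inj₁ (∣ᵤ⇒∣ e)
    ... | inj₂ e = inj₂ (∣ᵤ⇒∣ e)

    ι : Fin p → ℤ
    ι i = + toℕ i

    res : ℤ → Fin p
    res x = fromℕ< (n%ℕd<d x p)

    ι-res : ∀ x → x ≈ ι (res x)
    ι-res x = mod (divides (x ℤ./ℕ p) (trans
      (cong₂ _-_ (a≡a%ℕn+[a/ℕn]*n x p) (cong +_ (Fin.toℕ-fromℕ< (n%ℕd<d x p))))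
      (lemma (+ (x ℤ.%ℕ p)) _)))
      where
      lemma : ∀ r q → (r + q) - r ≡ q
      lemma = solve-∀

    ∣-small : ∀ i → ℤ.∣ i ∣ ℕ.< p → + p ∣ i → i ≡ 0ℤ
    ∣-small i i<p d with ℤ.∣ i ∣ in eq | ∣⇒∣ᵤ d
    ... | zero  | _ = ℤ.∣i∣≡0⇒i≡0 eq
    ... | suc n | e = contradiction e (ℕ.>⇒∤ i<p)

    ι-injective : ∀ {i j} → ι i ≈ ι j → i ≡ j
    ι-injective {i} {j} (mod d) = Fin.toℕ-injective (ℤ.+-injective (ℤ.i-j≡0⇒i≡j (ι i) (ι j)
      (∣-small _ (ℕ.≤-<-trans bound (ℕ.⊔-lub (Fin.toℕ<n i) (Fin.toℕ<n j))) d)))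
      where
      bound : ℤ.∣ ι i - ι j ∣ ℕ.≤ toℕ i ℕ.⊔ toℕ j
      bound = ℕ.≤-trans (ℕ.≤-reflexive (cong ℤ.∣_∣ (ℤ.m-n≡m⊖n (toℕ i) (toℕ j)))) (ℤ.∣m⊝n∣≤m⊔n (toℕ i) (toℕ j))

    -- Polynomial functions and the number of their roots.

    -- Functions of degree n modulo p, described by their difference quotients;
    -- the leading coefficient is prime to p.
    Deg : ℕ → (ℤ → ℤ) → Set
    Deg zero    f = ∃[ c ] (¬ + p ∣ c × ∀ y → f y ≡ c)
    Deg (suc n) f = ∀ a → ∃[ g ] (Deg n g × ∀ y → f y - f a ≡ (y - a) * g y)

    -- The summand of lower degree cannot affect the leading coefficient: difference quotients lower
    -- both degrees together, until g is constant and cancels.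
    Deg-+ : ∀ n b f g → Deg (suc n) f → Deg n g → Deg (suc n) (λ y → f y + b * g y)
    Deg-+ zero b f g F (c , _ , g≡c) a =
      let (f₁ , F₁ , e) = F a in
      f₁ , F₁ , λ y → trans (cong₂ (λ u v → (f y + b * u) - (f a + b * v)) (g≡c y) (g≡c a))
                            (trans (lemma (f y) (f a) (b * c)) (e y))
      where
      lemma : ∀ u v w → (u + w) - (v + w) ≡ u - v
      lemma = solve-∀
    Deg-+ (suc n) b f g F G a =
      let (f₁ , F₁ , e) = F a ; (g₁ , G₁ , e′) = G a in
      (λ y → f₁ y + b * g₁ y) , Deg-+ n b f₁ g₁ F₁ G₁ , λ y → begin
        (f y + b * g y) - (f a + b * g a)        ≡⟨ lemma (f y) (f a) b (g y) (g a) ⟩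
        (f y - f a) + b * (g y - g a)            ≡⟨ cong₂ (λ u v → u + b * v) (e y) (e′ y) ⟩
        (y - a) * f₁ y + b * ((y - a) * g₁ y)    ≡⟨ lemma′ (y - a) (f₁ y) b (g₁ y) ⟩
        (y - a) * (f₁ y + b * g₁ y)              ∎
      where
      open ≡-Reasoning
      lemma : ∀ u v b u′ v′ → (u + b * u′) - (v + b * v′) ≡ (u - v) + b * (u′ - v′)
      lemma = solve-∀
      lemma′ : ∀ w u b v → w * u + b * (w * v) ≡ w * (u + b * v)
      lemma′ = solve-∀

    -- A product rule: if f₁ is the difference quotient of f at a, then that of y f(y) is f(y) + a
    -- f₁(y), whose degree is given by `Deg-+`.
    Deg-* : ∀ n f → Deg n f → Deg (suc n) (λ y → y * f y)
    Deg-* zero f F@(c , _ , f≡c) a = f , F , λ y → trans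
      (cong (λ v → y * f y - a * v) (trans (f≡c a) (sym (f≡c y)))) (lemma y a (f y))
      where
      lemma : ∀ y a u → y * u - a * u ≡ (y - a) * u
      lemma = solve-∀
    Deg-* (suc n) f F a =
      let (f₁ , F₁ , e) = F a in
      (λ y → f y + a * f₁ y) , Deg-+ n a f f₁ F F₁ , λ y → begin
        y * f y - a * f a                  ≡⟨ lemma y a (f y) (f a) ⟩
        (y - a) * f y + a * (f y - f a)    ≡⟨ cong (λ u → (y - a) * f y + a * u) (e y) ⟩
        (y - a) * f y + a * ((y - a) * f₁ y) ≡⟨ lemma′ (y - a) (f y) a (f₁ y) ⟩
        (y - a) * (f y + a * f₁ y)         ∎
      where
      open ≡-Reasoning
      lemma : ∀ y a u v → y * u - a * v ≡ (y - a) * u + a * (u - v)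
      lemma = solve-∀
      lemma′ : ∀ w u b v → w * u + b * (w * v) ≡ w * (u + b * v)
      lemma′ = solve-∀

    p∤1 : ¬ + p ∣ 1ℤ
    p∤1 d with ∣-small 1ℤ (ℕ.nonTrivial⇒n>1 p {{prime⇒nonTrivial p-prime}}) d
    ... | ()

    Deg-^ : ∀ k → Deg k (_^ k)
    Deg-^ zero    = 1ℤ , p∤1 , λ _ → refl
    Deg-^ (suc k) = Deg-* k (_^ k) (Deg-^ k)

    Deg-affine : ∀ t {c} → ¬ + p ∣ c → Deg 1 (λ s → s * c + t)
    Deg-affine t {c} p∤c a = (λ _ → c) , (c , p∤c , λ _ → refl) , λ y → lemma y a c t
      where
      lemma : ∀ y a c t → (y * c + t) - (a * c + t) ≡ (y - a) * c
      lemma = solve-∀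

    Deg-shift : ∀ {n} f c → Deg (suc n) f → Deg (suc n) (λ y → f y - c)
    Deg-shift f c F a = let (g , G , e) = F a in
      g , G , λ y → trans (lemma (f y) (f a) c) (e y)
      where
      lemma : ∀ u v w → (u - w) - (v - w) ≡ u - v
      lemma = solve-∀

    roots : (ℤ → ℤ) → ℤ
    roots f = ∑[ i < p ] 𝟙 (+ p ∣? f (ι i))

    noRoots : ∀ f → (∀ i → ¬ + p ∣ f (ι i)) → roots f ≡ 0ℤ
    noRoots f ∤ = trans (sum-cong-≗ {p} (λ i → 𝟙-false (+ p ∣? f (ι i)) (∤ i))) (sum-replicate-zero p)

    -- Lagrange's theorem. At a root j, the difference quotient g satisfies f(y) ≡ (y - j) g(y) mod
    -- p, so by Euclid's lemma every root other than j is a root of g, which has lower degree.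
    lagrange : ∀ n f → Deg n f → roots f ≤ + n
    lagrange zero f (c , p∤c , f≡c) =
      ℤ.≤-reflexive (noRoots f (λ i d → p∤c (subst (+ p ∣_) (f≡c (ι i)) d)))
    lagrange (suc n) f F with Fin.any? (λ i → + p ∣? f (ι i))
    ... | no  none = ℤ.≤-trans (ℤ.≤-reflexive (noRoots f (λ i d → none (i , d)))) (ℤ.+≤+ z≤n)
    ... | yes (j , dj) = let (g , G , e) = F (ι j) in begin
        roots f
          ≤⟨ sum-mono {p} (λ i → 𝟙-⊎ (+ p ∣? f (ι i)) (i Fin.≟ j) (+ p ∣? g (ι i)) (split g i (e (ι i)))) ⟩
        ∑[ i < p ] (𝟙 (i Fin.≟ j) + 𝟙 (+ p ∣? g (ι i)))
          ≡⟨ ∑-distrib-+ {p} (λ i → 𝟙 (i Fin.≟ j)) (λ i → 𝟙 (+ p ∣? g (ι i))) ⟩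
        ∑[ i < p ] 𝟙 (i Fin.≟ j) + roots g
          ≤⟨ ℤ.+-mono-≤ (ℤ.≤-reflexive (∑-𝟙-≟ j)) (lagrange n g G) ⟩
        + suc n ∎
      where
      open ℤ.≤-Reasoning
      split : ∀ g i → f (ι i) - f (ι j) ≡ (ι i - ι j) * g (ι i) → + p ∣ f (ι i) → i ≡ j ⊎ + p ∣ g (ι i)
      split g i e di with euclid (ι i - ι j) (g (ι i)) (subst (+ p ∣_) e (∣m∣n⇒∣m-n di dj))
      ... | inj₁ d = inj₁ (ι-injective (mod d))
      ... | inj₂ d = inj₂ d

    -- Sums of periodic functions over all residues.

    Periodic : (ℤ → ℤ) → Set
    Periodic G = ∀ {x y} → x ≈ y → G x ≡ G y

    total : (ℤ → ℤ) → ℤ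
    total G = ∑[ i < p ] G (ι i)

    -- Group the arguments by the value of f: by `lagrange` applied to f - c, each residue c is
    -- taken at most n + 1 times, and G is non-negative.
    total-∘ : ∀ n f {G} → Deg (suc n) f → Periodic G → (∀ x → 0ℤ ≤ G x) →
              total (G ∘ f) ≤ + suc n * total G
    total-∘ n f {G} F per 0≤G = begin
        total (G ∘ f)
          ≤⟨ sum-mono {p} (λ i → expand i) ⟩
        ∑[ i < p ] ∑[ j < p ] (𝟙 (hit i j) * G (ι j))
          ≡⟨ ∑-comm (λ i j → 𝟙 (hit i j) * G (ι j)) ⟩
        ∑[ j < p ] ∑[ i < p ] (𝟙 (hit i j) * G (ι j))
          ≡⟨ sum-cong-≗ {p} (λ j → sym (*-distribʳ-sum (G (ι j)) (λ i → 𝟙 (hit i j)))) ⟩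
        ∑[ j < p ] (∑[ i < p ] 𝟙 (hit i j) * G (ι j))
          ≤⟨ sum-mono {p} (λ j → ℤ.*-monoʳ-≤-nonNeg (G (ι j)) {{ℤ.nonNegative (0≤G (ι j))}}
               (lagrange (suc n) (λ y → f y - ι j) (Deg-shift f (ι j) F))) ⟩
        ∑[ j < p ] (+ suc n * G (ι j))
          ≡⟨ sym (*-distribˡ-sum (+ suc n) (λ j → G (ι j))) ⟩
        + suc n * total G ∎
      where
      open ℤ.≤-Reasoning
      hit : ∀ i j → Dec (+ p ∣ f (ι i) - ι j)
      hit i j = + p ∣? (f (ι i) - ι j)
      -- By periodicity G (f i) is the term of index `res (f i)`; the other terms are non-negative.
      expand : ∀ i → G (f (ι i)) ≤ ∑[ j < p ] (𝟙 (hit i j) * G (ι j))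
      expand i = let j = res (f (ι i)) ; e = ι-res (f (ι i)) in ℤ.≤-trans
        (ℤ.≤-reflexive (trans (per e) (sym (trans
          (cong (_* G (ι j)) (𝟙-true (hit i j) (divisible e))) (ℤ.*-identityˡ _)))))
        (term≤sum (λ j → *-nonNeg (𝟙-nonNeg (hit i j)) (0≤G (ι j))) j)

    -- A translation has degree 1, so `total-∘` gives one inequality; the other is the same
    -- inequality for the translated function and the shift -c.
    total-translate : ∀ {G} → Periodic G → (∀ x → 0ℤ ≤ G x) → ∀ c → total (λ t → G (c + t)) ≡ total G
    total-translate {G} per 0≤G c = ℤ.≤-antisym (shift G per 0≤G c) (ℤ.≤-trans
      (ℤ.≤-reflexive (sum-cong-≗ {p} (λ i → cong G (lemma c (ι i)))))
      (shift (λ t → G (c + t)) (λ e → per (+-cong-≈ (≈-refl {c}) e)) (λ x → 0≤G (c + x)) (- c)))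
      where
      lemma : ∀ c t → t ≡ c + (- c + t)
      lemma = solve-∀
      lemma′ : ∀ c t → c + t ≡ t * 1ℤ + c
      lemma′ = solve-∀
      shift : ∀ G → Periodic G → (∀ x → 0ℤ ≤ G x) → ∀ c → total (λ t → G (c + t)) ≤ total G
      shift G per 0≤G c = ℤ.≤-trans (ℤ.≤-reflexive (sum-cong-≗ {p} (λ i → cong G (lemma′ c (ι i)))))
        (ℤ.≤-trans (total-∘ 0 (λ s → s * 1ℤ + c) (Deg-affine c p∤1) per 0≤G) (ℤ.≤-reflexive (ℤ.*-identityˡ _)))

    -- The second moment argument for a set without power differences.

    -- A is the indicator function of a set of residues no two of which differ by
    -- a nonzero (suc k′)-th power.
    module PowerFree (k′ : ℕ) (A : ℤ → ℤ) (A-periodic : Periodic A)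
      (A-values : ∀ x → A x ≡ 0ℤ ⊎ A x ≡ 1ℤ)
      (A-free : ∀ (x : Fin m) t → A t ≡ 1ℤ → A (ι (suc x) ^ suc k′ + t) ≡ 0ℤ) where

      k : ℕ
      k = suc k′

      a : ℤ
      a = total A

      A-nonNeg : ∀ x → 0ℤ ≤ A x
      A-nonNeg x with A-values x
      ... | inj₁ e = ℤ.≤-reflexive (sym e)
      ... | inj₂ e = ℤ.≤-trans (ℤ.+≤+ z≤n) (ℤ.≤-reflexive (sym e))

      A≤1 : ∀ x → A x ≤ 1ℤ
      A≤1 x with A-values x
      ... | inj₁ e = ℤ.≤-trans (ℤ.≤-reflexive e) (ℤ.+≤+ z≤n)
      ... | inj₂ e = ℤ.≤-reflexive e

      a-nonNeg : 0ℤ ≤ a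
      a-nonNeg = sum-nonneg {p} (λ i → A-nonNeg (ι i))

      -- Counts the x for which the point u = xᵏ of the line v = s u + t has A v = 1.
      T : ℤ → ℤ → ℤ
      T s t = ∑[ x < p ] A (s * ι x ^ k + t)

      T-periodic : ∀ {s s′} t → s ≈ s′ → T s t ≡ T s′ t
      T-periodic {s} {s′} t e = sum-cong-≗ {p} λ x →
        A-periodic (+-cong-≈ (*-cong-≈ e (≈-refl {ι x ^ k})) (≈-refl {t}))

      ∑∑ : (ℤ → ℤ → ℤ) → ℤ
      ∑∑ F = ∑[ s < p ] ∑[ t < p ] F (ι s) (ι t)

      ∑∑-∑ : ∀ {n} (F : Fin n → ℤ → ℤ → ℤ) → ∑∑ (λ s t → ∑[ x < n ] F x s t) ≡ ∑[ x < n ] ∑∑ (F x)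
      ∑∑-∑ F = trans (sum-cong-≗ {p} (λ s → ∑-comm (λ t x → F x (ι s) (ι t))))
                     (∑-comm (λ s x → ∑[ t < p ] F x (ι s) (ι t)))

      ∑∑-cong : ∀ {F G : ℤ → ℤ → ℤ} → (∀ s t → F s t ≡ G s t) → ∑∑ F ≡ ∑∑ G
      ∑∑-cong e = sum-cong-≗ {p} λ s → sum-cong-≗ {p} λ t → e (ι s) (ι t)

      ∑∑-+ : ∀ (F G : ℤ → ℤ → ℤ) → ∑∑ (λ s t → F s t + G s t) ≡ ∑∑ F + ∑∑ G
      ∑∑-+ F G = trans
        (sum-cong-≗ {p} λ s → ∑-distrib-+ {p} (λ t → F (ι s) (ι t)) (λ t → G (ι s) (ι t)))
        (∑-distrib-+ {p} (λ s → ∑[ t < p ] F (ι s) (ι t)) (λ s → ∑[ t < p ] G (ι s) (ι t)))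

      ∑∑-* : ∀ c (F : ℤ → ℤ → ℤ) → ∑∑ (λ s t → c * F s t) ≡ c * ∑∑ F
      ∑∑-* c F = trans
        (sum-cong-≗ {p} λ s → sym (*-distribˡ-sum {p} c (λ t → F (ι s) (ι t))))
        (sym (*-distribˡ-sum {p} c (λ s → ∑[ t < p ] F (ι s) (ι t))))

      ∑∑-const : ∀ c → ∑∑ (λ _ _ → c) ≡ + p * (+ p * c)
      ∑∑-const c = trans (sum-cong-≗ {p} λ s → sum-const p c) (sum-const p (+ p * c))

      ∑∑-mono : ∀ {F G : ℤ → ℤ → ℤ} → (∀ s t → F s t ≤ G s t) → ∑∑ F ≤ ∑∑ G
      ∑∑-mono e = sum-mono {p} λ s → sum-mono {p} λ t → e (ι s) (ι t)

      -- Replacing s u + t by t turns the sum into one of A(t) A(s (v - u) + t). If p does not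
      -- divide v - u, then for fixed t the point s (v - u) + t meets each residue at most once, so
      -- the sum over s is at most a; otherwise it is bounded trivially by p.
      correlation : ∀ u v → ∑∑ (λ s t → A (s * u + t) * A (s * v + t))
                          ≤ a * a + 𝟙 (+ p ∣? (v - u)) * (+ p * a)
      correlation u v = begin
          ∑∑ (λ s t → A (s * u + t) * A (s * v + t))
            ≡⟨ ∑∑-cong (λ s t → cong (λ z → A (s * u + t) * A z) (lemma s u v t)) ⟩
          ∑[ s < p ] total (λ t → G (ι s) (ι s * u + t))
            ≡⟨ sum-cong-≗ {p} (λ s → total-translate (G-periodic (ι s))
                 (λ t → *-nonNeg (A-nonNeg t) (A-nonNeg _)) (ι s * u)) ⟩
          ∑[ s < p ] ∑[ t < p ] G (ι s) (ι t)
            ≡⟨ ∑-comm (λ s t → G (ι s) (ι t)) ⟩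
          ∑[ t < p ] ∑[ s < p ] (A (ι t) * A (ι s * w + ι t))
            ≡⟨ sum-cong-≗ {p} (λ t → sym (*-distribˡ-sum {p} (A (ι t)) (λ s → A (ι s * w + ι t)))) ⟩
          ∑[ t < p ] (A (ι t) * ∑[ s < p ] A (ι s * w + ι t))
            ≤⟨ sum-mono {p} (λ t → ℤ.*-monoˡ-≤-nonNeg (A (ι t)) {{ℤ.nonNegative (A-nonNeg (ι t))}} (row (ι t) (+ p ∣? w))) ⟩
          ∑[ t < p ] (A (ι t) * (a + 𝟙 (+ p ∣? w) * + p))
            ≡⟨ sym (*-distribʳ-sum {p} (a + 𝟙 (+ p ∣? w) * + p) (λ t → A (ι t))) ⟩
          a * (a + 𝟙 (+ p ∣? w) * + p)
            ≡⟨ lemma′ a (𝟙 (+ p ∣? w)) (+ p) ⟩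
          a * a + 𝟙 (+ p ∣? w) * (+ p * a) ∎
        where
        open ℤ.≤-Reasoning
        w = v - u
        G : ℤ → ℤ → ℤ
        G s t = A t * A (s * w + t)
        G-periodic : ∀ s → Periodic (G s)
        G-periodic s e = cong₂ _*_ (A-periodic e) (A-periodic (+-cong-≈ (≈-refl {s * w}) e))
        lemma : ∀ s u v t → s * v + t ≡ s * (v - u) + (s * u + t)
        lemma = solve-∀
        lemma′ : ∀ a e q → a * (a + e * q) ≡ a * a + e * (q * a)
        lemma′ = solve-∀
        row : ∀ t (d : Dec (+ p ∣ w)) → ∑[ s < p ] A (ι s * w + t) ≤ a + 𝟙 d * + p
        row t (no p∤w) = ℤ.≤-trans (total-∘ 0 (λ s → s * w + t) (Deg-affine t p∤w) A-periodic A-nonNeg)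
                         (ℤ.≤-reflexive (trans (ℤ.*-identityˡ a) (sym (ℤ.+-identityʳ a))))
        row t (yes _)  = ℤ.≤-trans (sum-mono {p} (λ s → A≤1 (ι s * w + t)))
                         (ℤ.≤-trans (ℤ.≤-reflexive (trans (sum-const p 1ℤ) (trans (ℤ.*-comm (+ p) 1ℤ) (sym (ℤ.+-identityˡ (1ℤ * + p))))))
                           (ℤ.+-monoˡ-≤ (1ℤ * + p) a-nonNeg))

      -- Expand the square over pairs (x, x′) and apply `correlation`. For each x the extra term p a
      -- occurs only when x′ᵏ ≡ xᵏ, that is, for at most k values of x′.
      secondMoment : ∑∑ (λ s t → T s t * T s t) ≤ + p * (+ p * (a * a) + + k * (+ p * a))
      secondMoment = begin
          ∑∑ (λ s t → T s t * T s t)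
            ≡⟨ ∑∑-cong (λ s t → square s t) ⟩
          ∑∑ (λ s t → ∑[ x < p ] ∑[ x′ < p ] h x x′ s t)
            ≡⟨ trans (∑∑-∑ (λ x s t → ∑[ x′ < p ] h x x′ s t)) (sum-cong-≗ {p} (λ x → ∑∑-∑ (λ x′ → h x x′))) ⟩
          ∑[ x < p ] ∑[ x′ < p ] ∑∑ (h x x′)
            ≤⟨ sum-mono {p} (λ x → sum-mono {p} (λ x′ → correlation (ι x ^ k) (ι x′ ^ k))) ⟩
          ∑[ x < p ] ∑[ x′ < p ] (a * a + δ x x′ * (+ p * a))
            ≡⟨ sum-cong-≗ {p} (λ x → trans (∑-distrib-+ {p} (λ _ → a * a) (λ x′ → δ x x′ * (+ p * a)))
                 (cong₂ _+_ (sum-const p (a * a)) (sym (*-distribʳ-sum {p} (+ p * a) (δ x))))) ⟩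
          ∑[ x < p ] (+ p * (a * a) + ∑[ x′ < p ] δ x x′ * (+ p * a))
            ≤⟨ sum-mono {p} (λ x → ℤ.+-monoʳ-≤ (+ p * (a * a))
                 (ℤ.*-monoʳ-≤-nonNeg (+ p * a) {{ℤ.nonNegative (*-nonNeg (ℤ.+≤+ {0} {p} z≤n) a-nonNeg)}}
                   (lagrange k (λ y → y ^ k - ι x ^ k) (Deg-shift (_^ k) (ι x ^ k) (Deg-^ k))))) ⟩
          ∑[ x < p ] (+ p * (a * a) + + k * (+ p * a))
            ≡⟨ sum-const p (+ p * (a * a) + + k * (+ p * a)) ⟩
          + p * (+ p * (a * a) + + k * (+ p * a)) ∎
        where
        open ℤ.≤-Reasoning
        h : Fin p → Fin p → ℤ → ℤ → ℤ
        h x x′ s t = A (s * ι x ^ k + t) * A (s * ι x′ ^ k + t)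
        δ : Fin p → Fin p → ℤ
        δ x x′ = 𝟙 (+ p ∣? (ι x′ ^ k - ι x ^ k))
        square : ∀ s t → T s t * T s t ≡ ∑[ x < p ] ∑[ x′ < p ] h x x′ s t
        square s t = trans (*-distribʳ-sum {p} (T s t) (λ x → A (s * ι x ^ k + t)))
          (sum-cong-≗ {p} (λ x → *-distribˡ-sum {p} (A (s * ι x ^ k + t)) (λ x′ → A (s * ι x′ ^ k + t))))

      -- For fixed s and x, the point s xᵏ + t runs over all residues with t.
      firstMoment : ∑∑ T ≡ + p * (+ p * a)
      firstMoment = trans (∑∑-∑ (λ x s t → A (s * ι x ^ k + t))) (trans
        (sum-cong-≗ {p} (λ x → trans
          (sum-cong-≗ {p} (λ s → total-translate A-periodic A-nonNeg (ι s * ι x ^ k)))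
          (sum-const p a)))
        (sum-const p (+ p * a)))

      dev : ℤ → ℤ → ℤ
      dev s t = (T s t - a) * (T s t - a)

      -- By `firstMoment` the mean of T over the p² lines is a, so the main terms p² a² cancel and
      -- only the excess in `secondMoment` from pairs with equal powers remains.
      variance : ∑∑ dev ≤ + p * (+ k * (+ p * a))
      variance = begin
          ∑∑ dev
            ≡⟨ ∑∑-cong (λ s t → lemma (T s t) a) ⟩
          ∑∑ (λ s t → T s t * T s t + ((- (a + a)) * T s t + a * a))
            ≡⟨ trans (∑∑-+ (λ s t → T s t * T s t) (λ s t → (- (a + a)) * T s t + a * a))
                 (cong (λ z → ∑∑ (λ s t → T s t * T s t) + z) (trans (∑∑-+ (λ s t → (- (a + a)) * T s t) (λ _ _ → a * a))
                   (cong₂ _+_ (trans (∑∑-* (- (a + a)) T) (cong (λ z → (- (a + a)) * z) firstMoment)) (∑∑-const (a * a))))) ⟩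
          ∑∑ (λ s t → T s t * T s t) + ((- (a + a)) * (+ p * (+ p * a)) + + p * (+ p * (a * a)))
            ≤⟨ ℤ.+-monoˡ-≤ ((- (a + a)) * (+ p * (+ p * a)) + + p * (+ p * (a * a))) secondMoment ⟩
          + p * (+ p * (a * a) + + k * (+ p * a)) + ((- (a + a)) * (+ p * (+ p * a)) + + p * (+ p * (a * a)))
            ≡⟨ lemma′ (+ p) (+ k) a ⟩
          + p * (+ k * (+ p * a)) ∎
        where
        open ℤ.≤-Reasoning
        lemma : ∀ u a → (u - a) * (u - a) ≡ u * u + ((- (a + a)) * u + a * a)
        lemma = solve-∀
        lemma′ : ∀ q k a → q * (q * (a * a) + k * (q * a)) + ((- (a + a)) * (q * (q * a)) + q * (q * (a * a)))
                         ≡ q * (k * (q * a))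
        lemma′ = solve-∀

      -- As A avoids t + (y x)ᵏ for x ≢ 0, only x = 0 contributes.
      T-on-powers : ∀ (y : Fin m) t → A t ≡ 1ℤ → T (ι (suc y) ^ k) t ≡ 1ℤ
      T-on-powers y t At = cong₂ _+_
        (trans (cong A (lemma (ι (suc y) ^ k) (0ℤ ^ k′) t)) At)
        (trans (sum-cong-≗ {m} avoid) (sum-replicate-zero m))
        where
        lemma : ∀ u v t → u * (0ℤ * v) + t ≡ t
        lemma = solve-∀
        ∤ι-suc : ∀ (x : Fin m) → ¬ + p ∣ ι (suc x)
        ∤ι-suc x d with ∣-small (ι (suc x)) (Fin.toℕ<n (suc x)) d
        ... | ()
        ^-distrib-* : ∀ n u v → (u * v) ^ n ≡ u ^ n * v ^ n
        ^-distrib-* zero    u v = refl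
        ^-distrib-* (suc n) u v = trans (cong (λ z → u * v * z) (^-distrib-* n u v)) (swap u v (u ^ n) (v ^ n))
          where
          swap : ∀ u v u′ v′ → u * v * (u′ * v′) ≡ u * u′ * (v * v′)
          swap = solve-∀
        -- The product yᵏ xᵏ is (y x)ᵏ, and y x reduces to a nonzero residue z because p divides
        -- neither factor; `A-free` then applies to z.
        avoid : ∀ x → A (ι (suc y) ^ k * ι (suc x) ^ k + t) ≡ 0ℤ
        avoid x with res (ι (suc y) * ι (suc x)) | ι-res (ι (suc y) * ι (suc x))
        ... | zero  | mod d with euclid (ι (suc y)) (ι (suc x)) (subst (+ p ∣_) (ℤ.+-identityʳ _) d)
        ...   | inj₁ e = contradiction e (∤ι-suc y)
        ...   | inj₂ e = contradiction e (∤ι-suc x)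
        avoid x | suc z | e = trans
          (A-periodic (+-cong-≈ (≈-trans (≈-reflexive (sym (^-distrib-* k (ι (suc y)) (ι (suc x))))) (^-cong-≈ k e)) (≈-refl {t})))
          (A-free z t At)

      -- By `T-on-powers`, each slope s = yᵏ with y ≢ 0 has deviation (1 - a)² at all a points t of
      -- the set. Summing over the m values of y counts each slope at most k times, so the total is
      -- at most k times the bound of `variance`.
      size-bound : + m * (a * ((1ℤ - a) * (1ℤ - a))) ≤ + k * (+ p * (+ k * (+ p * a)))
      size-bound = begin
          + m * (a * ((1ℤ - a) * (1ℤ - a)))
            ≡⟨ sym (trans (sum-cong-≗ {m} on-powers) (sum-const m _)) ⟩
          ∑[ y < m ] G (ι (suc y) ^ k)
            ≡⟨ sym (ℤ.+-identityˡ (∑[ y < m ] G (ι (suc y) ^ k))) ⟩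
          -- The non-negative term for y = 0 completes the range to all residues.
          0ℤ + ∑[ y < m ] G (ι (suc y) ^ k)
            ≤⟨ ℤ.+-monoˡ-≤ (∑[ y < m ] G (ι (suc y) ^ k)) (G-nonNeg (ι zero ^ k)) ⟩
          total (λ y → G (y ^ k))
            ≤⟨ total-∘ k′ (_^ k) (Deg-^ k) G-periodic G-nonNeg ⟩
          + k * total G
            ≤⟨ ℤ.*-monoˡ-≤-nonNeg (+ k) (ℤ.≤-trans (∑∑-mono drop-A) variance) ⟩
          + k * (+ p * (+ k * (+ p * a))) ∎
        where
        open ℤ.≤-Reasoning
        G : ℤ → ℤ
        G s = ∑[ t < p ] (A (ι t) * dev s (ι t))
        dev-nonNeg : ∀ s t → 0ℤ ≤ dev s t
        dev-nonNeg s t = square-nonNeg (T s t - a)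
        G-nonNeg : ∀ s → 0ℤ ≤ G s
        G-nonNeg s = sum-nonneg {p} (λ t → *-nonNeg (A-nonNeg (ι t)) (dev-nonNeg s (ι t)))
        G-periodic : Periodic G
        G-periodic e = sum-cong-≗ {p} λ t →
          cong (λ z → A (ι t) * ((z - a) * (z - a))) (T-periodic (ι t) e)
        drop-A : ∀ s t → A t * dev s t ≤ dev s t
        drop-A s t = ℤ.≤-trans (ℤ.*-monoʳ-≤-nonNeg (dev s t) {{ℤ.nonNegative (dev-nonNeg s t)}} (A≤1 t))
                               (ℤ.≤-reflexive (ℤ.*-identityˡ (dev s t)))
        on-powers : ∀ y → G (ι (suc y) ^ k) ≡ a * ((1ℤ - a) * (1ℤ - a))
        on-powers y = trans (sum-cong-≗ {p} pointwise) (sym (*-distribʳ-sum {p} _ (λ t → A (ι t))))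
          where
          pointwise : ∀ t → A (ι t) * dev (ι (suc y) ^ k) (ι t) ≡ A (ι t) * ((1ℤ - a) * (1ℤ - a))
          pointwise t with A-values (ι t)
          ... | inj₁ e = trans (cong (λ z → z * dev (ι (suc y) ^ k) (ι t)) e) (sym (cong (λ z → z * ((1ℤ - a) * (1ℤ - a))) e))
          ... | inj₂ e = cong (λ z → A (ι t) * ((z - a) * (z - a))) (T-on-powers y (ι t) e)

    res-cong : ∀ {x y} → x ≈ y → res x ≡ res y
    res-cong {x} {y} e = ι-injective (≈-trans (≈-sym (ι-res x)) (≈-trans e (ι-res y)))

    -- Power differences inside a colour class.

    module Colouring (k′ K : ℕ) (colour : Fin p → Fin K) where

      k : ℕ
      k = suc k′

      shifted : Fin m → Fin p → Fin p
      shifted x t = res (ι (suc x) ^ k + ι t)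

      -- Otherwise no colour class contains a difference that is a nonzero k-th power, and
      -- `size-bound` with `no-large-class` gives K |class| ≤ p - 1 for each class. Summed over the
      -- K classes, which cover all residues, this reads K p ≤ K (p - 1).
      collision : 8 ℕ.* ((K ℕ.* k) ℕ.* (K ℕ.* k)) ℕ.≤ p → ∃[ x ] ∃[ t ] colour (shifted x t) ≡ colour t
      collision 8K²k²≤p with Fin.any? (λ x → Fin.any? (λ t → colour (shifted x t) Fin.≟ colour t))
      ... | yes found = found
      ... | no  none  = contradiction
          (begin
            + K * + p                              ≡⟨ cong (λ z → + K * z) covering ⟨
            + K * ∑[ j < K ] total (A j)           ≡⟨ *-distribˡ-sum {K} (+ K) (λ j → total (A j)) ⟩
            ∑[ j < K ] (+ K * total (A j))         ≤⟨ sum-mono {K} small ⟩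
            ∑[ j < K ] (+ m)                       ≡⟨ sum-const K (+ m) ⟩
            + K * + m                              ∎)
          (ℤ.<⇒≱ (ℤ.*-monoˡ-<-pos (+ K) {{ℤ.positive (ℤ.+<+ 1≤K)}} (ℤ.+<+ (ℕ.n<1+n m))))
        where
        open ℤ.≤-Reasoning
        1≤K : 1 ℕ.≤ K
        1≤K = ℕ.≤-trans (s≤s z≤n) (Fin.toℕ<n (colour zero))

        -- Passing through `res` extends the class to a function on ℤ that is periodic modulo p.
        A : Fin K → ℤ → ℤ
        A j x = 𝟙 (colour (res x) Fin.≟ j)

        A-values : ∀ j x → A j x ≡ 0ℤ ⊎ A j x ≡ 1ℤ
        A-values j x with colour (res x) Fin.≟ j
        ... | yes _ = inj₂ refl
        ... | no  _ = inj₁ refl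

        A≡1⇒ : ∀ j x → A j x ≡ 1ℤ → colour (res x) ≡ j
        A≡1⇒ j x e with colour (res x) Fin.≟ j
        ... | yes c = c

        A-free : ∀ j (x : Fin m) t → A j t ≡ 1ℤ → A j (ι (suc x) ^ k + t) ≡ 0ℤ
        A-free j x t At = 𝟙-false (colour (res (ι (suc x) ^ k + t)) Fin.≟ j) λ c →
          none (x , res t , trans
            (trans (cong colour (res-cong (+-cong-≈ (≈-refl {ι (suc x) ^ k}) (≈-sym (ι-res t))))) c)
            (sym (A≡1⇒ j t At)))

        covering : ∑[ j < K ] total (A j) ≡ + p
        covering = trans (∑-comm (λ j i → A j (ι i))) (trans
          (sum-cong-≗ {p} (λ i → trans (sum-cong-≗ {K} (λ j → 𝟙-≟-sym (colour (res (ι i))) j)) (∑-𝟙-≟ (colour (res (ι i))))))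
          (trans (sum-const p 1ℤ) (ℤ.*-identityʳ (+ p))))
          where
          𝟙-≟-sym : ∀ {n} (i j : Fin n) → 𝟙 (i Fin.≟ j) ≡ 𝟙 (j Fin.≟ i)
          𝟙-≟-sym i j with i Fin.≟ j
          ... | yes e = sym (𝟙-true (j Fin.≟ i) (sym e))
          ... | no ¬e = sym (𝟙-false (j Fin.≟ i) (¬e ∘ sym))

        small : ∀ j → + K * total (A j) ≤ + m
        small j = conclude (total (A j)) P.a-nonNeg P.size-bound
          where
          module P = PowerFree k′ (A j) (λ e → cong (λ i → 𝟙 (colour i Fin.≟ j)) (res-cong e)) (A-values j) (A-free j)
          conclude : ∀ a → 0ℤ ≤ a → + m * (a * ((1ℤ - a) * (1ℤ - a))) ≤ + k * (+ p * (+ k * (+ p * a))) → + K * a ≤ + m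
          conclude (+ zero)  _ _ = ℤ.≤-trans (ℤ.≤-reflexive (ℤ.*-zeroʳ (+ K))) (ℤ.+≤+ z≤n)
          -- With a = b + 1 the factor (1 - a)² becomes b², as in `no-large-class`.
          conclude (+ suc b) _ h with K ℕ.* suc b ℕ.≤? m
          ... | yes q = ℤ.≤-trans (ℤ.≤-reflexive (sym (ℤ.pos-* K (suc b)))) (ℤ.+≤+ q)
          ... | no ¬q = contradiction (ℕ.≰⇒> ¬q) (no-large-class {m} {k} {K} {b} (s≤s z≤n) 1≤K 8K²k²≤p
                (ℤ.drop‿+≤+ (begin
                  + (m ℕ.* (suc b ℕ.* (b ℕ.* b)))
                    ≡⟨ trans (ℤ.pos-* m _) (cong (λ z → + m * z) (trans (ℤ.pos-* (suc b) _) (cong (λ z → + suc b * z) (trans (ℤ.pos-* b b) (square (+ b)))))) ⟩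
                  + m * (+ suc b * ((1ℤ - + suc b) * (1ℤ - + suc b)))
                    ≤⟨ h ⟩
                  + k * (+ p * (+ k * (+ p * + suc b)))
                    ≡⟨⟩
                  + (k ℕ.* (p ℕ.* (k ℕ.* (p ℕ.* suc b)))) ∎)))
            where
            square : ∀ b → b * b ≡ (1ℤ - (1ℤ + b)) * (1ℤ - (1ℤ + b))
            square = solve-∀

    -- From a collision to simultaneous approximation.

    module Approximation (k′ D : ℕ) {d : ℕ} (r : Fin d → ℤ) (1≤D : 1 ℕ.≤ D) where

      -- The index of the interval of length p/D that contains u.
      cell : Fin p → Fin D
      cell u = fromℕ< {D ℕ.* toℕ u ℕ./ p} (ℕ.m<n*o⇒m/o<n {D ℕ.* toℕ u} {D} {p}
        (ℕ.*-monoʳ-< D {{ℕ.>-nonZero 1≤D}} (Fin.toℕ<n u)))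

      image : Fin d → Fin p → Fin p
      image i t = res (ι t * r i)

      -- The d cells are encoded as one number below Dᵈ, so that they form a colour.
      box : Fin p → Fin (D ℕ.^ d)
      box t = funToFin (λ i → cell (image i t))

      cell-width : ∀ u v → cell u ≡ cell v → D ℕ.* ℤ.∣ ι u - ι v ∣ ℕ.< p
      cell-width u v e = ℕ.≤-<-trans (ℕ.≤-reflexive scale)
        (∣-∣<-divisor (D ℕ.* toℕ u) (D ℕ.* toℕ v) p
          (trans (sym (Fin.toℕ-fromℕ< _)) (trans (cong toℕ e) (Fin.toℕ-fromℕ< _))))
        where
        open ≡-Reasoning
        lemma : ∀ D u v → D * (u - v) ≡ D * u - D * v
        lemma = solve-∀
        scale : D ℕ.* ℤ.∣ ι u - ι v ∣ ≡ ℤ.∣ + (D ℕ.* toℕ u) - + (D ℕ.* toℕ v) ∣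
        scale = begin
          D ℕ.* ℤ.∣ ι u - ι v ∣       ≡⟨ ℤ.abs-* (+ D) (ι u - ι v) ⟨
          ℤ.∣ + D * (ι u - ι v) ∣     ≡⟨ cong ℤ.∣_∣ (lemma (+ D) (ι u) (ι v)) ⟩
          ℤ.∣ + D * ι u - + D * ι v ∣ ≡⟨ cong₂ (λ y z → ℤ.∣ y - z ∣) (ℤ.pos-* D (toℕ u)) (ℤ.pos-* D (toℕ v)) ⟨
          ℤ.∣ + (D ℕ.* toℕ u) - + (D ℕ.* toℕ v) ∣ ∎

      -- Use `box` as the colouring. If t and t′ ≡ xᵏ + t share a box, then xᵏ r is congruent to the
      -- difference of the residues of t′ r and t r, which lie in one cell.
      approximation : let K = D ℕ.^ d ; k = suc k′ in
        8 ℕ.* ((K ℕ.* k) ℕ.* (K ℕ.* k)) ℕ.≤ p →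
        ∃[ x ] (1 ℕ.≤ x × x ℕ.< p × (∀ i → ∃[ n ] D ℕ.* ℤ.∣ (+ x) ^ k * r i - n * + p ∣ ℕ.< p))
      approximation h =
        let (x , t , e) = Colouring.collision k′ (D ℕ.^ d) box h in
        suc (toℕ x) , s≤s z≤n , s≤s (Fin.toℕ<n x) , λ i → close x t e i
        where
        k = suc k′
        module _ (x : Fin m) (t : Fin p) where
          t′ : Fin p
          t′ = res (ι (suc x) ^ k + ι t)

          congruent : ∀ i → ι (suc x) ^ k * r i ≈ ι (image i t′) - ι (image i t)
          congruent i = ≈-trans
            (≈-reflexive (lemma (ι (suc x) ^ k) (ι t) (r i)))
            (+-cong-≈
              (≈-trans (*-cong-≈ (ι-res (ι (suc x) ^ k + ι t)) (≈-refl {r i})) (ι-res (ι t′ * r i)))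
              (neg (ι-res (ι t * r i))))
            where
            lemma : ∀ u t r → u * r ≡ (u + t) * r - t * r
            lemma = solve-∀
            lemma′ : ∀ u v → v - u ≡ - u - - v
            lemma′ = solve-∀
            neg : ∀ {u v} → u ≈ v → - u ≈ - v
            neg {u} {v} e = mod (subst (+ p ∣_) (lemma′ u v) (divisible (≈-sym e)))

          close : box t′ ≡ box t → ∀ i → ∃[ n ] D ℕ.* ℤ.∣ ι (suc x) ^ k * r i - n * + p ∣ ℕ.< p
          close e i with congruent i
          -- The quotient n of the congruence is the integer sought: subtracting n p leaves exactly
          -- the difference of the two residues.
          ... | mod (divides n n-eq) = n , ℕ.≤-<-trans
              (ℕ.≤-reflexive (cong (λ z → D ℕ.* ℤ.∣ z ∣) (trans (cong (λ z → ι (suc x) ^ k * r i - z) (sym n-eq)) (lemma (ι (suc x) ^ k * r i) _))))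
              (cell-width (image i t′) (image i t) same)
            where
            lemma : ∀ u v → u - (u - v) ≡ v
            lemma = solve-∀
            same : cell (image i t′) ≡ cell (image i t)
            same = trans (sym (Fin.finToFun-funToFin (λ i → cell (image i t′)) i))
              (trans (cong (λ c → finToFun {D} {d} c i) e) (Fin.finToFun-funToFin (λ i → cell (image i t)) i))

module Rationals where

  open import Defs using (_^_)
  open import Algebra.Bundles using (CommutativeRing)
  open import Data.Bool.Base using (true; false)
  open import Data.Integer.DivMod using ([n/d]*d≤n; n<s[n/ℕd]*d; div-pos-is-/ℕ)
  open import Data.Integer.Tactic.RingSolver using () renaming (solve-∀ to ℤ-solve-∀)
  import Data.Nat.Coprimality as Coprime
  open import Data.Rational.Base hiding (NonZero)
  open import Data.Rational.Properties
  import Data.Rational.Unnormalised.Base as ℚᵘ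
  import Data.Rational.Unnormalised.Properties as ℚᵘ
  open import Data.Rational.Solver using (module +-*-Solver)
  open +-*-Solver using (solve; _:=_; _:+_; _:*_; :-_; _:-_; con)
  open import Algebra.Properties.CommutativeSemiring.Exp (CommutativeRing.commutativeSemiring +-*-commutativeRing)
    using (^-distrib-*; ^-homo-*)

  -- Integers inside the rationals, and monotonicity of powers.

  infix 9 ⟦_⟧
  ⟦_⟧ : ℤ → ℚ
  ⟦ i ⟧ = i / 1

  -- For a variable i the fraction `i / 1` is stuck on its normalisation by a gcd; the explicit form
  -- lets arithmetic compute.
  ⟦⟧-mkℚ : ∀ i → ⟦ i ⟧ ≡ mkℚ i 0 (Coprime.sym (Coprime.1-coprimeTo ℤ.∣ i ∣))
  ⟦⟧-mkℚ i = ↥p/↧p≡p (mkℚ i 0 (Coprime.sym (Coprime.1-coprimeTo ℤ.∣ i ∣)))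

  ⟦⟧-* : ∀ i j → ⟦ i ℤ.* j ⟧ ≡ ⟦ i ⟧ * ⟦ j ⟧
  ⟦⟧-* i j = sym (cong₂ _*_ (⟦⟧-mkℚ i) (⟦⟧-mkℚ j))

  ⟦⟧-+ : ∀ i j → ⟦ i ℤ.+ j ⟧ ≡ ⟦ i ⟧ + ⟦ j ⟧
  ⟦⟧-+ i j = trans (cong ⟦_⟧ (sym (cong₂ ℤ._+_ (ℤ.*-identityʳ i) (ℤ.*-identityʳ j))))
    (sym (cong₂ _+_ (⟦⟧-mkℚ i) (⟦⟧-mkℚ j)))

  ⟦⟧-neg : ∀ i → ⟦ ℤ.- i ⟧ ≡ - ⟦ i ⟧
  ⟦⟧-neg i = trans (⟦⟧-mkℚ (ℤ.- i)) (trans (lemma i) (cong -_ (sym (⟦⟧-mkℚ i))))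
    where
    lemma : ∀ i → mkℚ (ℤ.- i) 0 (Coprime.sym (Coprime.1-coprimeTo ℤ.∣ ℤ.- i ∣))
                ≡ - mkℚ i 0 (Coprime.sym (Coprime.1-coprimeTo ℤ.∣ i ∣))
    lemma (+ zero)  = refl
    lemma (+ suc n) = refl
    lemma ℤ.-[1+ n ] = refl

  ⟦⟧-- : ∀ i j → ⟦ i ℤ.- j ⟧ ≡ ⟦ i ⟧ - ⟦ j ⟧
  ⟦⟧-- i j = trans (⟦⟧-+ i (ℤ.- j)) (cong (λ q → ⟦ i ⟧ + q) (⟦⟧-neg j))

  ⟦⟧-∣∣ : ∀ i → ∣ ⟦ i ⟧ ∣ ≡ ⟦ + ℤ.∣ i ∣ ⟧
  ⟦⟧-∣∣ i = trans (cong ∣_∣ (⟦⟧-mkℚ i)) (sym (⟦⟧-mkℚ (+ ℤ.∣ i ∣)))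

  ⟦⟧-mono-≤ : ∀ {i j} → i ℤ.≤ j → ⟦ i ⟧ ≤ ⟦ j ⟧
  ⟦⟧-mono-≤ {i} {j} i≤j = subst₂ _≤_ (sym (⟦⟧-mkℚ i)) (sym (⟦⟧-mkℚ j))
    (*≤* (ℤ.*-monoʳ-≤-nonNeg 1ℤ i≤j))

  ⟦⟧-nonNeg : ∀ n → NonNegative ⟦ + n ⟧
  ⟦⟧-nonNeg n = normalize-nonNeg n 1

  0≤⟦_⟧ : ∀ n → 0ℚ ≤ ⟦ + n ⟧
  0≤⟦ n ⟧ = nonNegative⁻¹ ⟦ + n ⟧ {{⟦⟧-nonNeg n}}

  ⟦⟧-^ : ∀ m n → ⟦ + (m ℕ.^ n) ⟧ ≡ ⟦ + m ⟧ ^ n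
  ⟦⟧-^ m zero    = refl
  ⟦⟧-^ m (suc n) = trans (cong ⟦_⟧ (ℤ.pos-* m (m ℕ.^ n)))
    (trans (⟦⟧-* (+ m) (+ (m ℕ.^ n))) (cong (λ q → ⟦ + m ⟧ * q) (⟦⟧-^ m n)))

  /-*-cancel : ∀ i n .{{_ : NonZero n}} → (i / n) * ⟦ + n ⟧ ≡ ⟦ i ⟧
  /-*-cancel i n@(suc n-1) = toℚᵘ-injective (begin
    toℚᵘ ((i / n) * ⟦ + n ⟧)                     ≈⟨ toℚᵘ-homo-* (i / n) ⟦ + n ⟧ ⟩
    toℚᵘ (i / n) ℚᵘ.* toℚᵘ ⟦ + n ⟧               ≈⟨ ℚᵘ.*-cong (toℚᵘ-fromℚᵘ (ℚᵘ.mkℚᵘ i n-1)) (toℚᵘ-fromℚᵘ (ℚᵘ.mkℚᵘ (+ n) 0)) ⟩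
    ℚᵘ.mkℚᵘ i n-1 ℚᵘ.* ℚᵘ.mkℚᵘ (+ n) 0           ≈⟨ ℚᵘ.*≡* (lemma i (+ n)) ⟩
    ℚᵘ.mkℚᵘ i 0                                  ≈⟨ toℚᵘ-fromℚᵘ (ℚᵘ.mkℚᵘ i 0) ⟨
    toℚᵘ ⟦ i ⟧                                   ∎)
    where
    open ℚᵘ.≃-Reasoning
    lemma : ∀ i n → i ℤ.* n ℤ.* 1ℤ ≡ i ℤ.* (n ℤ.* 1ℤ)
    lemma = ℤ-solve-∀

  *-mono-≤ : ∀ {p q r s} → 0ℚ ≤ p → 0ℚ ≤ s → p ≤ q → r ≤ s → p * r ≤ q * s
  *-mono-≤ {p} {q} {r} {s} 0≤p 0≤s p≤q r≤s = ≤-trans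
    (*-monoˡ-≤-nonNeg p {{nonNegative 0≤p}} r≤s) (*-monoʳ-≤-nonNeg s {{nonNegative 0≤s}} p≤q)

  0≤* : ∀ {p q} → 0ℚ ≤ p → 0ℚ ≤ q → 0ℚ ≤ p * q
  0≤* {p} {q} 0≤p 0≤q =
    nonNegative⁻¹ (p * q) {{nonNeg*nonNeg⇒nonNeg p {{nonNegative 0≤p}} q {{nonNegative 0≤q}}}}

  0≤^ : ∀ {q} → 0ℚ ≤ q → ∀ n → 0ℚ ≤ q ^ n
  0≤^ 0≤q zero    = nonNegative⁻¹ 1ℚ
  0≤^ 0≤q (suc n) = 0≤* 0≤q (0≤^ 0≤q n)

  ^-mono-≤ : ∀ {q r} → 0ℚ ≤ q → q ≤ r → ∀ n → q ^ n ≤ r ^ n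
  ^-mono-≤ 0≤q q≤r zero    = ≤-refl
  ^-mono-≤ 0≤q q≤r (suc n) = *-mono-≤ 0≤q (0≤^ (≤-trans 0≤q q≤r) n) q≤r (^-mono-≤ 0≤q q≤r n)

  ^<1 : ∀ {q} → 0ℚ ≤ q → q < 1ℚ → ∀ n → .{{NonZero n}} → q ^ n < 1ℚ
  ^<1 {q} 0≤q q<1 (suc n) = ≤-<-trans
    (≤-trans (*-monoˡ-≤-nonNeg q {{nonNegative 0≤q}} (subst (q ^ n ≤_) (1^ n) (^-mono-≤ 0≤q (<⇒≤ q<1) n)))
             (≤-reflexive (*-identityʳ q)))
    q<1
    where
    1^ : ∀ n → 1ℚ ^ n ≡ 1ℚ
    1^ zero    = refl
    1^ (suc n) = trans (*-identityˡ (1ℚ ^ n)) (1^ n)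

  -- Rounding and the distance to the nearest integer.

  ∣∣≤ : ∀ {x y} → x ≤ y → - x ≤ y → ∣ x ∣ ≤ y
  ∣∣≤ {x} x≤y -x≤y with ∣p∣≡p∨∣p∣≡-p x
  ... | inj₁ e = ≤-trans (≤-reflexive e) x≤y
  ... | inj₂ e = ≤-trans (≤-reflexive e) -x≤y

  floor-≤ : ∀ q → ⟦ floor q ⟧ ≤ q
  floor-≤ q@(mkℚ n d _) = subst (_≤ q) (sym (⟦⟧-mkℚ (floor q)))
    (*≤* (ℤ.≤-trans ([n/d]*d≤n n (+ suc d)) (ℤ.≤-reflexive (sym (ℤ.*-identityʳ n)))))

  <-floor+1 : ∀ q → q < 1ℚ + ⟦ floor q ⟧
  <-floor+1 q@(mkℚ n d _) = subst (q <_)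
    (trans (sym (⟦⟧-mkℚ (ℤ.suc (floor q)))) (⟦⟧-+ 1ℤ (floor q)))
    (*<* (ℤ.≤-<-trans (ℤ.≤-reflexive (ℤ.*-identityʳ n))
      (ℤ.<-≤-trans (n<s[n/ℕd]*d n (suc d))
        (ℤ.≤-reflexive (cong (λ i → ℤ.suc i ℤ.* + suc d) (sym (div-pos-is-/ℕ n (suc d))))))))

  ceiling-neg : ∀ q → ceiling q ≡ ℤ.- floor (- q)
  ceiling-neg (mkℚ _ _ _) = refl

  -- Halves are rounded away from zero: `round` is the floor of θ + ½ for θ > 0 and the ceiling of θ
  -- - ½ otherwise. Both cases reduce to floor q ≤ q < floor q + 1.
  ∣θ-round∣≤½ : ∀ θ → ∣ θ - ⟦ round θ ⟧ ∣ ≤ ½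
  ∣θ-round∣≤½ θ with θ ≤ᵇ 0ℚ
  ... | false = let q = θ + ½ ; f = ⟦ floor q ⟧ in ∣∣≤
      (≤-trans (≤-trans (≤-reflexive (solve 2 (λ θ f → θ :- f := (θ :+ con ½) :- f :- con ½) refl θ f))
          (+-monoˡ-≤ (- ½) (+-monoˡ-≤ (- f) (<⇒≤ (<-floor+1 q)))))
        (≤-reflexive (solve 1 (λ f → con 1ℚ :+ f :- f :- con ½ := con ½) refl f)))
      (≤-trans (≤-trans (≤-reflexive (solve 2 (λ θ f → :- (θ :- f) := f :- θ) refl θ f))
          (+-monoˡ-≤ (- θ) (floor-≤ q)))
        (≤-reflexive (solve 1 (λ θ → θ :+ con ½ :- θ := con ½) refl θ)))
  ... | true = let q = - (θ - ½) ; f = ⟦ floor q ⟧ in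
      subst (λ i → ∣ θ - i ∣ ≤ ½) (sym (trans (cong ⟦_⟧ (ceiling-neg (θ - ½))) (⟦⟧-neg (floor q)))) (∣∣≤
      (≤-trans (≤-trans (≤-reflexive (solve 2 (λ θ f → θ :- (:- f) := f :+ θ) refl θ f))
          (+-monoˡ-≤ θ (floor-≤ q)))
        (≤-reflexive (solve 1 (λ θ → :- (θ :- con ½) :+ θ := con ½) refl θ)))
      (≤-trans (≤-trans (≤-reflexive (solve 2 (λ θ f → :- (θ :- (:- f)) := :- (θ :- con ½) :- f :- con ½) refl θ f))
          (+-monoˡ-≤ (- ½) (+-monoˡ-≤ (- f) (<⇒≤ (<-floor+1 q)))))
        (≤-reflexive (solve 1 (λ f → con 1ℚ :+ f :- f :- con ½ := con ½) refl f))))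

  -- If n differs from the rounded value N, then 1 ≤ |n - N| ≤ ½ + |θ - n|, so |θ - n| is at least
  -- ½.
  round-nearest : ∀ θ n → ∣ θ - ⟦ round θ ⟧ ∣ ≤ ∣ θ - ⟦ n ⟧ ∣
  round-nearest θ n with round θ ℤ.≟ n
  ... | yes refl = ≤-refl
  ... | no  N≢n  = ≤-trans (∣θ-round∣≤½ θ) (≤-trans
      (+-monoˡ-≤ (- ½) 1≤½+∣θ-n∣)
      (≤-reflexive (solve 1 (λ x → con ½ :+ x :- con ½ := x) refl ∣ θ - ⟦ n ⟧ ∣)))
    where
    N = round θ
    open ≤-Reasoning
    1≤∣∣ : ∀ i → i ≢ 0ℤ → 1ℤ ℤ.≤ + ℤ.∣ i ∣
    1≤∣∣ (+ zero)  i≢0 = contradiction refl i≢0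
    1≤∣∣ (+ suc _) _   = ℤ.+≤+ (s≤s z≤n)
    1≤∣∣ ℤ.-[1+ _ ] _  = ℤ.+≤+ (s≤s z≤n)
    1≤½+∣θ-n∣ : 1ℚ ≤ ½ + ∣ θ - ⟦ n ⟧ ∣
    1≤½+∣θ-n∣ = begin
      1ℚ                                    ≤⟨ ⟦⟧-mono-≤ (1≤∣∣ (n ℤ.- N) (λ e → N≢n (sym (ℤ.i-j≡0⇒i≡j n N e)))) ⟩
      ⟦ + ℤ.∣ n ℤ.- N ∣ ⟧                   ≡⟨ ⟦⟧-∣∣ (n ℤ.- N) ⟨
      ∣ ⟦ n ℤ.- N ⟧ ∣                       ≡⟨ cong ∣_∣ (⟦⟧-- n N) ⟩
      ∣ ⟦ n ⟧ - ⟦ N ⟧ ∣                     ≡⟨ cong ∣_∣ (solve 3 (λ θ u v → u :- v := (θ :- v) :- (θ :- u)) refl θ ⟦ n ⟧ ⟦ N ⟧) ⟩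
      ∣ (θ - ⟦ N ⟧) - (θ - ⟦ n ⟧) ∣         ≤⟨ ∣p-q∣≤∣p∣+∣q∣ (θ - ⟦ N ⟧) (θ - ⟦ n ⟧) ⟩
      ∣ θ - ⟦ N ⟧ ∣ + ∣ θ - ⟦ n ⟧ ∣         ≤⟨ +-monoˡ-≤ ∣ θ - ⟦ n ⟧ ∣ (∣θ-round∣≤½ θ) ⟩
      ½ + ∣ θ - ⟦ n ⟧ ∣                     ∎

  -- The rounded value is at least as close to z/p as n, and p (z/p - n) = z - n p.
  distance-bound : ∀ z n D p .{{_ : NonZero p}} → D ℕ.* ℤ.∣ z ℤ.- n ℤ.* + p ∣ ℕ.< p →
    ∣ z / p - ⟦ round (z / p) ⟧ ∣ * ⟦ + D ⟧ ≤ 1ℚ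
  distance-bound z n D p h = ≤-trans
    (*-monoʳ-≤-nonNeg ⟦ + D ⟧ {{⟦⟧-nonNeg D}} (round-nearest (z / p) n))
    (*-cancelʳ-≤-pos ⟦ + p ⟧ {{normalize-pos p 1}} (begin
      ∣ θ - ⟦ n ⟧ ∣ * ⟦ + D ⟧ * ⟦ + p ⟧
        ≡⟨ solve 3 (λ x d p → x :* d :* p := d :* (x :* p)) refl ∣ θ - ⟦ n ⟧ ∣ ⟦ + D ⟧ ⟦ + p ⟧ ⟩
      ⟦ + D ⟧ * (∣ θ - ⟦ n ⟧ ∣ * ⟦ + p ⟧)
        ≡⟨ cong (λ q → ⟦ + D ⟧ * q) (trans (cong (λ q → ∣ θ - ⟦ n ⟧ ∣ * q) (sym (⟦⟧-∣∣ (+ p)))) (sym (∣p*q∣≡∣p∣*∣q∣ (θ - ⟦ n ⟧) ⟦ + p ⟧))) ⟩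
      ⟦ + D ⟧ * ∣ (θ - ⟦ n ⟧) * ⟦ + p ⟧ ∣
        ≡⟨ cong (λ q → ⟦ + D ⟧ * ∣ q ∣) numerator ⟩
      ⟦ + D ⟧ * ∣ ⟦ z ℤ.- n ℤ.* + p ⟧ ∣
        ≡⟨ cong (λ q → ⟦ + D ⟧ * q) (⟦⟧-∣∣ (z ℤ.- n ℤ.* + p)) ⟩
      ⟦ + D ⟧ * ⟦ + ℤ.∣ z ℤ.- n ℤ.* + p ∣ ⟧
        ≡⟨ trans (sym (⟦⟧-* (+ D) _)) (cong ⟦_⟧ (sym (ℤ.pos-* D _))) ⟩
      ⟦ + (D ℕ.* ℤ.∣ z ℤ.- n ℤ.* + p ∣) ⟧
        ≤⟨ ⟦⟧-mono-≤ (ℤ.+≤+ (ℕ.<⇒≤ h)) ⟩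
      ⟦ + p ⟧
        ≡⟨ *-identityˡ ⟦ + p ⟧ ⟨
      1ℚ * ⟦ + p ⟧ ∎))
    where
    open ≤-Reasoning
    θ = z / p
    numerator : (θ - ⟦ n ⟧) * ⟦ + p ⟧ ≡ ⟦ z ℤ.- n ℤ.* + p ⟧
    numerator = trans (solve 3 (λ t u v → (t :- u) :* v := t :* v :- u :* v) refl θ ⟦ n ⟧ ⟦ + p ⟧)
      (trans (cong₂ _-_ (/-*-cancel z p) (sym (⟦⟧-* n (+ p)))) (sym (⟦⟧-- z (n ℤ.* + p))))

  -- A lower bound for the logarithm.

  1/n≤1 : ∀ n .{{_ : NonZero n}} → + 1 / n ≤ 1ℚ
  1/n≤1 n@(suc _) = ≤-trans
    (≤-trans (≤-reflexive (sym (*-identityʳ (+ 1 / n))))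
      (*-monoˡ-≤-nonNeg (+ 1 / n) {{normalize-nonNeg 1 n}} (⟦⟧-mono-≤ {1ℤ} {+ n} (ℤ.+≤+ (s≤s z≤n)))))
    (≤-reflexive (/-*-cancel (+ 1) n))

  -- Comparison with the geometric series. The summand ½ ^ N is the slack that closes the induction:
  -- the next term uses at most half of it, and the other half is the new slack.
  expSum-≤2 : ∀ {s} → 0ℚ ≤ s → s ≤ ½ → ∀ N → expSum N s + ½ ^ N ≤ ⟦ + 2 ⟧
  expSum-≤2 0≤s s≤½ zero = ≤-refl
  expSum-≤2 {s} 0≤s s≤½ (suc N) = begin
      expSum N s + s ^ suc N * c + ½ ^ suc N
        ≤⟨ +-monoˡ-≤ (½ ^ suc N) (+-monoʳ-≤ (expSum N s) (≤-trans
             (*-mono-≤ (0≤^ 0≤s (suc N)) (nonNegative⁻¹ 1ℚ) (^-mono-≤ 0≤s s≤½ (suc N)) (1/n≤1 (suc N !) {{ℕ._!≢0 (suc N)}}))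
             (≤-reflexive (*-identityʳ (½ ^ suc N))))) ⟩
      expSum N s + ½ * ½ ^ N + ½ * ½ ^ N
        ≡⟨ solve 2 (λ e h → e :+ con ½ :* h :+ con ½ :* h := e :+ h) refl (expSum N s) (½ ^ N) ⟩
      expSum N s + ½ ^ N
        ≤⟨ expSum-≤2 0≤s s≤½ N ⟩
      ⟦ + 2 ⟧ ∎
    where
    open ≤-Reasoning
    c = (+ 1 / (suc N !)) {{ℕ._!≢0 (suc N)}}

  -- For s < ½ all partial sums of exp s stay at or below 2 ≤ p, so every rational in the set
  -- defining `log p` is at least ½.
  ½≤log : ∀ {p N s} → 2 ℕ.≤ p → 0ℚ ≤ s → ⟦ + p ⟧ < expSum N s → ½ ≤ s
  ½≤log {p} {N} {s} 2≤p 0≤s p<exp with ½ ≤? s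
  ... | yes ½≤s = ½≤s
  ... | no  ½≰s = contradiction p<exp (≤⇒≯ (begin
      expSum N s            ≡⟨ +-identityʳ (expSum N s) ⟨
      expSum N s + 0ℚ       ≤⟨ +-monoʳ-≤ (expSum N s) (0≤^ (nonNegative⁻¹ ½) N) ⟩
      expSum N s + ½ ^ N    ≤⟨ expSum-≤2 0≤s (<⇒≤ (≰⇒> ½≰s)) N ⟩
      ⟦ + 2 ⟧               ≤⟨ ⟦⟧-mono-≤ (ℤ.+≤+ 2≤p) ⟩
      ⟦ + p ⟧               ∎))
    where
    open ≤-Reasoning
    ≤⇒≯ : ∀ {x y} → x ≤ y → ¬ y < x
    ≤⇒≯ x≤y y<x = <-irrefl refl (≤-<-trans x≤y y<x)

  -- Comparison of D with the two roots.

  ^-double : ∀ q d → q ^ (2 ℕ.* d) ≡ q ^ d * q ^ d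
  ^-double q d = trans (^-homo-* q d (d ℕ.+ 0)) (cong (λ n → q ^ d * q ^ n) (ℕ.+-identityʳ d))

  -- The factor 8 in the condition on p is absorbed by 3 inside a 2d-th power, whatever d is.
  8≤3^[2d] : ∀ d .{{_ : NonZero d}} → 8 ℕ.≤ 3 ℕ.^ (2 ℕ.* d)
  8≤3^[2d] d@(suc d-1) = ℕ.≤-trans (ℕ.n≤1+n 8) (ℕ.^-monoʳ-≤ 3 {2} {2 ℕ.* d} (ℕ.*-monoʳ-≤ 2 (s≤s (z≤n {d-1}))))

  -- Here α and β bound the roots of 1/p and k from above. The hypothesis gives p ≤ (3 β (D +
  -- 1))^(2d); multiplied by 1/p ≤ α^(2d) it says that the 2d-th power of the right-hand side is at
  -- least 1.
  1≤3αβ[1+D] : ∀ d .{{_ : NonZero d}} {D p k α β} .{{_ : NonZero p}} →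
    p ℕ.≤ 8 ℕ.* ((suc D ℕ.^ d ℕ.* k) ℕ.* (suc D ℕ.^ d ℕ.* k)) →
    0ℚ ≤ α → + 1 / p ≤ α ^ (2 ℕ.* d) → 0ℚ ≤ β → ⟦ + k ⟧ ≤ β ^ d →
    1ℚ ≤ α * (⟦ + 3 ⟧ * (β * ⟦ + suc D ⟧))
  1≤3αβ[1+D] d {D} {p} {k} {α} {β} p≤8K²k² 0≤α 1/p≤α 0≤β k≤β with 1ℚ ≤? α * (⟦ + 3 ⟧ * (β * ⟦ + suc D ⟧))
  ... | yes h = h
  ... | no ¬h = contradiction 1≤yⁿ (<⇒≱ (^<1 0≤y (≰⇒> ¬h) (2 ℕ.* d) {{ℕ.m*n≢0 2 d}}))
    where
    open ≤-Reasoning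
    <⇒≱ : ∀ {x y} → x < y → ¬ y ≤ x
    <⇒≱ x<y y≤x = <-irrefl refl (<-≤-trans x<y y≤x)
    n = 2 ℕ.* d
    Kk = suc D ℕ.^ d ℕ.* k
    M = ⟦ + suc D ⟧
    w = β * M
    y = α * (⟦ + 3 ⟧ * w)
    0≤w : 0ℚ ≤ w
    0≤w = 0≤* 0≤β 0≤⟦ suc D ⟧
    0≤y : 0ℚ ≤ y
    0≤y = 0≤* 0≤α (0≤* 0≤⟦ 3 ⟧ 0≤w)
    ⟦⟧-*ℕ : ∀ m n → ⟦ + (m ℕ.* n) ⟧ ≡ ⟦ + m ⟧ * ⟦ + n ⟧
    ⟦⟧-*ℕ m n = trans (cong ⟦_⟧ (ℤ.pos-* m n)) (⟦⟧-* (+ m) (+ n))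
    Kk≤w^d : ⟦ + Kk ⟧ ≤ w ^ d
    Kk≤w^d = begin
      ⟦ + Kk ⟧                        ≡⟨ ⟦⟧-*ℕ (suc D ℕ.^ d) k ⟩
      ⟦ + (suc D ℕ.^ d) ⟧ * ⟦ + k ⟧   ≡⟨ *-comm ⟦ + (suc D ℕ.^ d) ⟧ ⟦ + k ⟧ ⟩
      ⟦ + k ⟧ * ⟦ + (suc D ℕ.^ d) ⟧   ≤⟨ *-monoʳ-≤-nonNeg ⟦ + (suc D ℕ.^ d) ⟧ {{⟦⟧-nonNeg (suc D ℕ.^ d)}} k≤β ⟩
      β ^ d * ⟦ + (suc D ℕ.^ d) ⟧     ≡⟨ cong (λ q → β ^ d * q) (⟦⟧-^ (suc D) d) ⟩
      β ^ d * M ^ d                   ≡⟨ ^-distrib-* β M d ⟨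
      w ^ d                           ∎
    p≤ : ⟦ + p ⟧ ≤ (⟦ + 3 ⟧ * w) ^ n
    p≤ = begin
      ⟦ + p ⟧                                 ≤⟨ ⟦⟧-mono-≤ (ℤ.+≤+ p≤8K²k²) ⟩
      ⟦ + (8 ℕ.* (Kk ℕ.* Kk)) ⟧               ≡⟨ trans (⟦⟧-*ℕ 8 (Kk ℕ.* Kk)) (cong (λ q → ⟦ + 8 ⟧ * q) (⟦⟧-*ℕ Kk Kk)) ⟩
      ⟦ + 8 ⟧ * (⟦ + Kk ⟧ * ⟦ + Kk ⟧)         ≤⟨ *-mono-≤ 0≤⟦ 8 ⟧ (0≤* (0≤^ 0≤w d) (0≤^ 0≤w d))
                                                   (⟦⟧-mono-≤ (ℤ.+≤+ (8≤3^[2d] d)))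
                                                   (*-mono-≤ 0≤⟦ Kk ⟧ (0≤^ 0≤w d) Kk≤w^d Kk≤w^d) ⟩
      ⟦ + (3 ℕ.^ n) ⟧ * (w ^ d * w ^ d)       ≡⟨ cong₂ _*_ (⟦⟧-^ 3 n) (sym (^-double w d)) ⟩
      ⟦ + 3 ⟧ ^ n * w ^ n                     ≡⟨ ^-distrib-* ⟦ + 3 ⟧ w n ⟨
      (⟦ + 3 ⟧ * w) ^ n                       ∎
    1≤yⁿ : 1ℚ ≤ y ^ n
    1≤yⁿ = begin
      1ℚ                          ≡⟨ /-*-cancel (+ 1) p ⟨
      + 1 / p * ⟦ + p ⟧           ≤⟨ *-mono-≤ (nonNegative⁻¹ (+ 1 / p) {{normalize-nonNeg 1 p}}) (0≤^ (0≤* 0≤⟦ 3 ⟧ 0≤w) n) 1/p≤α p≤ ⟩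
      α ^ n * (⟦ + 3 ⟧ * w) ^ n   ≡⟨ ^-distrib-* α (⟦ + 3 ⟧ * w) n ⟨
      y ^ n                       ∎

  -- Passes from D, which controls the distance, to D + 1, which controls p. For D = 0 all the
  -- information lies in e ≤ ½.
  *[1+D]≤2 : ∀ {e} D → e ≤ ½ → e * ⟦ + D ⟧ ≤ 1ℚ → e * ⟦ + suc D ⟧ ≤ ⟦ + 2 ⟧
  *[1+D]≤2 {e} D e≤½ eD≤1 = begin
    e * ⟦ + suc D ⟧         ≡⟨ cong (λ q → e * q) (⟦⟧-+ 1ℤ (+ D)) ⟩
    e * (1ℚ + ⟦ + D ⟧)      ≡⟨ solve 2 (λ e d → e :* (con 1ℚ :+ d) := e :+ e :* d) refl e ⟦ + D ⟧ ⟩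
    e + e * ⟦ + D ⟧         ≤⟨ +-mono-≤ (≤-trans e≤½ ½≤1) eD≤1 ⟩
    ⟦ + 2 ⟧                 ∎
    where
    open ≤-Reasoning
    ½≤1 : ½ ≤ 1ℚ
    ½≤1 = *≤* (ℤ.+≤+ (s≤s z≤n))

  -- The source of the constant: 2 from `*[1+D]≤2` times 3 from `1≤3αβ[1+D]`, doubled to make room
  -- for the lower bound ½ of the logarithm.
  ≤12α½β : ∀ {e D α β} → 0ℚ ≤ e → 0ℚ ≤ α → 0ℚ ≤ β → e * ⟦ + suc D ⟧ ≤ ⟦ + 2 ⟧ →
    1ℚ ≤ α * (⟦ + 3 ⟧ * (β * ⟦ + suc D ⟧)) → e ≤ ⟦ + 12 ⟧ * α * ½ * β
  ≤12α½β {e} {D} {α} {β} 0≤e 0≤α 0≤β eM≤2 1≤y = begin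
    e                                     ≡⟨ *-identityʳ e ⟨
    e * 1ℚ                                ≤⟨ *-monoˡ-≤-nonNeg e {{nonNegative 0≤e}} 1≤y ⟩
    e * (α * (⟦ + 3 ⟧ * (β * M)))         ≡⟨ solve 4 (λ e α β M → e :* (α :* (con ⟦ + 3 ⟧ :* (β :* M))) := (e :* M) :* (α :* (con ⟦ + 3 ⟧ :* β))) refl e α β M ⟩
    (e * M) * (α * (⟦ + 3 ⟧ * β))         ≤⟨ *-monoʳ-≤-nonNeg _ {{nonNegative (0≤* 0≤α (0≤* 0≤⟦ 3 ⟧ 0≤β))}} eM≤2 ⟩
    ⟦ + 2 ⟧ * (α * (⟦ + 3 ⟧ * β))         ≡⟨ solve 2 (λ α β → con ⟦ + 2 ⟧ :* (α :* (con ⟦ + 3 ⟧ :* β)) := con ⟦ + 12 ⟧ :* α :* con ½ :* β) refl α β ⟩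
    ⟦ + 12 ⟧ * α * ½ * β                  ∎
    where
    open ≤-Reasoning
    M = ⟦ + suc D ⟧

  -- The estimate for real numbers given as cuts.

  open ℝ≥0

  maxOver-upper : ∀ {X : Set} (Γ : List X) (f : X → ℝ≥0) {q} → 0ℚ < q →
    (∀ i → upper (f (lookup Γ i)) q) → upper (maxOver Γ f) q
  -- Positivity of q puts the base value 0 of the maximum below q.
  maxOver-upper []      f 0<q h = 0ℚ , refl , ≤-refl , 0<q
  maxOver-upper (_ ∷ Γ) f 0<q h = h zero , maxOver-upper Γ f 0<q (λ i → h (suc i))

  0<12 : 0ᵣ <ᵣ fromℕ 12
  0<12 = 1ℚ , (0ℚ , refl , ≤-refl , positive⁻¹ 1ℚ) ,
    λ { (_ , refl , _ , 12<1) → <-asym 12<1 (*<* (ℤ.+<+ (s≤s (s≤s z≤n)))) }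

  -- A rational q above the right-hand side comes with rational upper bounds for all four factors,
  -- so it is enough to bound each distance by the product of these.
  bound-holds : ∀ d .{{_ : NonZero d}} p .{{_ : NonZero p}} k D (Γ : List ℤ) (z : ℤ → ℤ) → 2 ℕ.≤ p →
    p ℕ.≤ 8 ℕ.* ((suc D ℕ.^ d ℕ.* k) ℕ.* (suc D ℕ.^ d ℕ.* k)) →
    (∀ i → ∃[ n ] D ℕ.* ℤ.∣ z (lookup Γ i) ℤ.- n ℤ.* + p ∣ ℕ.< p) →
    maxOver Γ (λ r → ‖ z r / p ‖)
      ≤ᵣ fromℕ 12 *ᵣ root (2 ℕ.* d) {{m*n≢0 2 d}} (1 /ᵣ p) *ᵣ log p *ᵣ root d (fromℕ k)
  -- The witnesses satisfy 12 < c, 1/p < α^(2d) with α < a, p < exp λ′ with λ′ < l, and k < βᵈ with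
  -- β < b; the products c a and `cα` * l lie below `cα` and `cαλ`, and `cαλ` * b lies below q.
  bound-holds d p k D Γ z 2≤p p≤8K²k² close {q}
    (_ , (cαλ , b ,
           (_ , (cα , l , (_ , (c , a , (_ , refl , _ , 12<c) , (α , (_ , refl , _ , 1/p<α) , 0≤α , α<a) , refl) , 0≤ca , ca<cα)
                        , (λ′ , (N , p<exp) , 0≤λ , λ<l) , refl) , 0≤cαl , cαl<cαλ)
              , (β , (_ , refl , _ , k<β) , 0≤β , β<b) , refl)
       , 0≤s , s<q) =
    maxOver-upper Γ (λ r → ‖ z r / p ‖) (≤-<-trans 0≤s s<q)
      (λ i → e (lookup Γ i) , refl , 0≤∣p∣ _ , ≤-<-trans (e≤s i) s<q)
    where
    open ≤-Reasoning
    e : ℤ → ℚ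
    e r = ∣ z r / p - ⟦ round (z r / p) ⟧ ∣
    1≤3αβM : 1ℚ ≤ α * (⟦ + 3 ⟧ * (β * ⟦ + suc D ⟧))
    1≤3αβM = 1≤3αβ[1+D] d {D} {p} {k} p≤8K²k² 0≤α (<⇒≤ 1/p<α) 0≤β (<⇒≤ k<β)
    0≤l : 0ℚ ≤ l
    0≤l = ≤-trans 0≤λ (<⇒≤ λ<l)
    0≤b : 0ℚ ≤ b
    0≤b = ≤-trans 0≤β (<⇒≤ β<b)
    0≤a : 0ℚ ≤ a
    0≤a = ≤-trans 0≤α (<⇒≤ α<a)
    0≤12α = 0≤* 0≤⟦ 12 ⟧ 0≤α
    e≤s : ∀ i → e (lookup Γ i) ≤ cαλ * b
    e≤s i = let (n , h) = close i ; r = lookup Γ i in begin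
      e r
        ≤⟨ ≤12α½β {D = D} (0≤∣p∣ _) 0≤α 0≤β (*[1+D]≤2 D (∣θ-round∣≤½ (z r / p)) (distance-bound (z r) n D p h)) 1≤3αβM ⟩
      ⟦ + 12 ⟧ * α * ½ * β
        ≤⟨ *-mono-≤ (0≤* 0≤12α (nonNegative⁻¹ ½)) 0≤b
             (≤-trans (*-mono-≤ 0≤12α 0≤l
               (≤-trans (*-mono-≤ 0≤⟦ 12 ⟧ 0≤a (<⇒≤ 12<c) (<⇒≤ α<a)) (<⇒≤ ca<cα))
               (≤-trans (½≤log {p} {N} 2≤p 0≤λ p<exp) (<⇒≤ λ<l))) (<⇒≤ cαl<cαλ)) (<⇒≤ β<b) ⟩
      cαλ * b ∎

-- The choice of D and the conclusion.

last-satisfying : ∀ {P : ℕ → Set} → (∀ n → Dec (P n)) → P 0 → ∀ n → ¬ P n → ∃[ D ] (P D × ¬ P (suc D))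
last-satisfying P? P0 zero    ¬P = contradiction P0 ¬P
last-satisfying P? P0 (suc n) ¬P with P? n
... | yes Pn = n , Pn , ¬P
... | no ¬Pn = last-satisfying P? P0 n ¬Pn

theorem2p3 : (d : ℕ) .{{_ : NonZero d}} →
    ∃[ C ] ∃[ p₀ ] (0ᵣ <ᵣ C ×
    ((p : ℕ) (p-prime : Prime p) → p₀ ℕ.≤ p →
    (k : ℕ) → 1 ℕ.≤ k →
    (Γ : List ℤ) → Unique Γ → length Γ ≡ d →
    ∃[ x ] (1 ℕ.≤ x × x ℕ.< p ×
    maxOver Γ (λ r → ‖ (((+ x) ℤ.^ k ℤ.* r) / p) {{prime⇒nonZero p-prime}} ‖)
    ≤ᵣ C *ᵣ root (2 ℕ.* d) {{m*n≢0 2 d}} ((1 /ᵣ p) {{prime⇒nonZero p-prime}})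
    *ᵣ log p {{prime⇒nonZero p-prime}}
    *ᵣ root d (fromℕ k))))
-- The constant 12 serves every d and every prime, so p₀ = 0.
theorem2p3 d@(suc d′) = fromℕ 12 , 0 , Rationals.0<12 , λ where
    zero    p-prime _ _ _ _ _ _ → contradiction p-prime ¬prime[0]
    (suc m) p-prime _ (suc k′) _ Γ _ len →
      -- D satisfies 8 (Dᵈ k)² ≤ p while D + 1 does not: the first yields the approximation, the
      -- second bounds p from above. The search starts at p + 1, where the condition fails, and ends
      -- at the latest at 0, where it holds because d ≥ 1.
      let (D , PD , ¬PD+1) = last-satisfying (λ D → budget m k′ D ℕ.≤? suc m) (fits m k′) (suc (suc m)) (exceeds m k′)
          (x , 1≤x , x<p , close) = approximate m p-prime k′ Γ len D PD
      in x , 1≤x , x<p , Rationals.bound-holds d (suc m) (suc k′) D Γ (λ r → (+ x) ℤ.^ suc k′ ℤ.* r)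
           (2≤ p-prime) (ℕ.<⇒≤ (ℕ.≰⇒> ¬PD+1)) close
  where
  budget : ℕ → ℕ → ℕ → ℕ
  budget m k′ D = 8 ℕ.* ((D ℕ.^ d ℕ.* suc k′) ℕ.* (D ℕ.^ d ℕ.* suc k′))
  fits : ∀ m k′ → budget m k′ 0 ℕ.≤ suc m
  fits m k′ = z≤n
  exceeds : ∀ m k′ → ¬ budget m k′ (suc (suc m)) ℕ.≤ suc m
  exceeds m k′ = ℕ.<⇒≱ (begin
      suc p                       ≡⟨ ℕ.*-identityʳ (suc p) ⟨
      suc p ℕ.* 1                 ≤⟨ ℕ.*-monoʳ-≤ (suc p) (ℕ.m^n>0 (suc p) d′) ⟩
      suc p ℕ.^ d                 ≤⟨ ℕ.m≤m*n (suc p ℕ.^ d) (suc k′) ⟩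
      W                           ≤⟨ ℕ.m≤m*n W W {{ℕ.m*n≢0 (suc p ℕ.^ d) (suc k′) {{ℕ.m^n≢0 (suc p) d}}}} ⟩
      W ℕ.* W                     ≤⟨ ℕ.m≤n*m (W ℕ.* W) 8 ⟩
      8 ℕ.* (W ℕ.* W)             ∎)
    where
    open ℕ.≤-Reasoning
    p = suc m
    W = suc p ℕ.^ d ℕ.* suc k′
  2≤ : ∀ {p} → Prime p → 2 ℕ.≤ p
  2≤ p-prime = ℕ.nonTrivial⇒n>1 _ {{prime⇒nonTrivial p-prime}}
  -- The exponent is a variable n, so that the equation with `length Γ` can be matched by `refl`.
  approximate : ∀ m → Prime (suc m) → ∀ k′ (Γ : List ℤ) {n} → length Γ ≡ n → ∀ D →
    8 ℕ.* ((D ℕ.^ n ℕ.* suc k′) ℕ.* (D ℕ.^ n ℕ.* suc k′)) ℕ.≤ suc m →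
    ∃[ x ] (1 ℕ.≤ x × x ℕ.< suc m ×
      (∀ i → ∃[ n ] D ℕ.* ℤ.∣ (+ x) ℤ.^ suc k′ ℤ.* lookup Γ i ℤ.- n ℤ.* + suc m ∣ ℕ.< suc m))
  -- D = 0 means k ≫ √p, when the claimed bound exceeds 1/2.
  approximate m p-prime k′ Γ _    zero    _ = 1 , ℕ.≤-refl , 2≤ p-prime , λ _ → 0ℤ , s≤s z≤n
  approximate m p-prime k′ Γ refl (suc D) h =
    PowerDifferences.Residues.Approximation.approximation m p-prime k′ (suc D) (lookup Γ) (s≤s z≤n) h
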